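{- Let $X$ be a pure finite $n$-dimensional simplicial complex, and assume there is a group $G$ of automorphisms of $X$ acting transitively on $X(n)$. Define $M_{ -1}=1$ and $M_k=\operatorname{Fill}_k((k+1)M_{k-1}+1)$ for $0\le k\le n-1$. Fix $0\le k\le n-1$. If $\operatorname{Sys}_j(X)>(j+1)M_{j-1}+1$ for every $0\le j\le k$, then $\operatorname{Exp}^k_b(X)\ge\frac{1}{\binom{n+1}{k+1}M_k}$.
   Context: $X(-1)=\{\emptyset\}$. Over $\mathbb{F}_2$: $C_k(X)$ has basis $X(k)$ (chains identified with subsets, $|A|$ the size), $\partial_k\sigma=\sum_{\tau\subset\sigma,|\tau|=|\sigma|-1}\tau$, $Z_k=\ker\partial_k$, $B_k=\operatorname{Im}\partial_{k+1}$. $\operatorname{Sys}_k(X)=\min\{|A|:A\in Z_k\setminus B_k\}$ ($\infty$ if $Z_k=B_k$). For $B\in B_k$, $\operatorname{Fill}_k(B)=\min\{|A|:\partial_{k+1}A=B\}$, for $B\in Z_k\setminus B_k$, $\operatorname{Fill}_k(B)=\infty$; $\operatorname{Fill}_k(M)=\max\{\operatorname{Fill}_k(B):B\in Z_k,|B|\le M\}$. $C^k(X)$ are functions $X(k)\to\mathbb{F}_2$, $d_k\phi(\sigma)=\sum_{\tau\subset\sigma,|\tau|=|\sigma|-1}\phi(\tau)$, $B^k=\operatorname{Im}d_{k-1}$; $w(\tau)=\frac{|\{\sigma\in X(n):\tau\subseteq\sigma\}|}{\binom{n+1}{k+1}|X(n)|}$ for $\tau\in X(k)$, $w(\phi)=\sum_{\tau\in\operatorname{supp}\phi}w(\tau)$;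 $\operatorname{Exp}^k_b(X)=\min\{\frac{w(d_k\phi)}{\min_{\psi\in B^k}w(\phi+\psi)}:\phi\in C^k\setminus B^k\}$. -}

module Defs where

open import Algebra.Bundles using (CommutativeRing)
open import Data.Bool.Base using (Bool; _∧_; _xor_; if_then_else_)
open import Data.Bool.Properties as Bool using (xor-∧-commutativeRing)
open import Data.Fin.Base using (Fin)
open import Data.Fin.Permutation as Perm using (Permutation′; _⟨$⟩ˡ_; _∘ₚ_)
open import Data.Fin.Subset using (Subset; inside; outside; ⁅_⁆; ⊥; _⊆_; ∣_∣)
open import Data.Fin.Subset.Properties using (_⊆?_; anySubset?)
import Data.Integer.Base as ℤ
open import Data.List.Base as List using (List; []; _∷_; _++_; filter; length)
import Data.List.Extrema as Extrema
import Data.Maybe.Base as Maybe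
open import Data.Nat.Base as ℕ using (ℕ; zero; suc)
open import Data.Nat.Combinatorics using (_C_)
import Data.Nat.Properties as ℕ
open import Data.Product.Base using (∃; _×_)
open import Data.Rational.Base as ℚ using (ℚ; 0ℚ)
import Data.Rational.Properties as ℚ
open import Data.Vec.Base as Vec using (Vec; tabulate; zipWith)
open import Data.Vec.Properties as Vec using ()
open import Function.Bundles using (_⇔_)
open import Level using (Level; 0ℓ) renaming (suc to lsuc)
open import Relation.Binary.Bundles using (TotalOrder)
import Relation.Binary.Construct.Add.Supremum.NonStrict as AddTop
import Relation.Binary.Construct.Add.Supremum.Strict as AddTopStrict
open import Relation.Binary.Definitions using (DecidableEquality)
open import Relation.Binary.PropositionalEquality.Core using (_≡_)
open import Relation.Nullary.Construct.Add.Supremum using (_⁺; [_]; ⊤⁺)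
open import Relation.Nullary.Decidable.Core using (does; yes; no; _×-dec_)
open import Relation.Unary using (Pred; Decidable)
open import Relation.Unary.Properties using (_∩?_; ∁?)

import Algebra.Properties.CommutativeMonoid.Sum as Sum
open Sum (CommutativeRing.+-commutativeMonoid xor-∧-commutativeRing)
  using () renaming (sum to sum₂)
open Sum ℚ.+-0-commutativeMonoid
  using () renaming (sum to sumℚ)

private
  variable
    v : ℕ
    ℓ : Level

-- ℕ and ℚ with a greatest element ∞ = ⊤⁺.

ℕ∞ ℚ∞ : Set
ℕ∞ = ℕ ⁺
ℚ∞ = ℚ ⁺

open AddTopStrict ℕ._<_ public using () renaming (_<⁺_ to _<∞_)
open AddTop ℚ._≤_ public using () renaming (_≤⁺_ to _≤ℚ∞_)

module ℕ≤ = AddTop ℕ._≤_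
module ℚ≤ = AddTop ℚ._≤_

ℕ∞-totalOrder ℚ∞-totalOrder ℚ-totalOrder : TotalOrder 0ℓ 0ℓ 0ℓ
ℕ∞-totalOrder = record { isTotalOrder = ℕ≤.≤⁺-isTotalOrder-≡ ℕ.≤-isTotalOrder }
ℚ∞-totalOrder = record { isTotalOrder = ℚ≤.≤⁺-isTotalOrder-≡ ℚ.≤-isTotalOrder }
ℚ-totalOrder  = record { isTotalOrder = ℚ.≤-isTotalOrder }

-- Total division, p ÷₀ 0 = 0.  If X is pure of dimension n and k < n, then all
-- denominators occurring in Exp X n k (including those in the weights) are
-- positive: every face lies in an n-face, so w φ = 0 only for φ = 0.

infixl 7 _÷₀_

_÷₀_ : ℚ → ℚ → ℚ
p ÷₀ q with q ℚ.≟ 0ℚ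
... | yes _   = 0ℚ
... | no  q≢0 = (p ℚ.÷ q) {{ℚ.≢-nonZero q≢0}}

fromℕ : ℕ → ℚ
fromℕ m = ℤ.+ m ℚ./ 1

-- 1/0 = ∞ and 1/∞ = 0, as usual in [0, ∞].

1/∞ : ℕ∞ → ℚ∞
1/∞ [ zero ]  = ⊤⁺
1/∞ [ suc m ] = [ ℤ.+ 1 ℚ./ suc m ]
1/∞ ⊤⁺        = [ 0ℚ ]

-- c · ∞ = ∞, so this is multiplication in ℕ ∪ {∞} for c > 0 only.

infixr 7 _·∞_

_·∞_ : ℕ → ℕ∞ → ℕ∞
c ·∞ x = Maybe.map (c ℕ.*_) x

infixl 6 _+∞_

_+∞_ : ℕ∞ → ℕ → ℕ∞
x +∞ c = Maybe.map (ℕ._+ c) x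

allSubsets : ∀ m → List (Subset m)
allSubsets zero    = Vec.[] ∷ []
allSubsets (suc m) = List.map (outside Vec.∷_) (allSubsets m)
                  ++ List.map (inside  Vec.∷_) (allSubsets m)

_≟ₛ_ : ∀ {m} → DecidableEquality (Subset m)
_≟ₛ_ = Vec.≡-dec Bool._≟_

-- A finite abstract simplicial complex with vertex set Fin v.  The empty set
-- is its unique face of dimension −1.

record SimplicialComplex (v : ℕ) : Set₁ where
  field
    Face     : Pred (Subset v) 0ℓ
    Face?    : Decidable Face
    empty    : Face ⊥
    vertex   : ∀ x → Face ⁅ x ⁆
    downward : ∀ {σ τ} → τ ⊆ σ → Face σ → Face τ

  -- Faces are graded by cardinality rather than by dimension, so that the
  -- dimension −1 is included: X(k) consists of the σ with IsFace (suc k) σ.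

  IsFace : ℕ → Pred (Subset v) 0ℓ
  IsFace s σ = Face σ × ∣ σ ∣ ≡ s

  isFace? : ∀ s → Decidable (IsFace s)
  isFace? s σ = Face? σ ×-dec (∣ σ ∣ ℕ.≟ s)

  faces : ℕ → List (Subset v)
  faces s = filter (isFace? s) (allSubsets v)

open SimplicialComplex public

IsPure : SimplicialComplex v → ℕ → Set
IsPure X n = ∀ σ → Face X σ → ∃ λ τ → IsFace X (suc n) τ × σ ⊆ τ

-- The direct image of σ under π.

infixr 8 _•_

_•_ : Permutation′ v → Subset v → Subset v
π • σ = tabulate λ y → Vec.lookup σ (π ⟨$⟩ˡ y)

IsAutomorphism : SimplicialComplex v → Permutation′ v → Set
IsAutomorphism X π = ∀ σ → Face X σ ⇔ Face X (π • σ)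

record AutomorphismGroup (X : SimplicialComplex v) ℓ : Set (lsuc ℓ) where
  field
    Member       : Pred (Permutation′ v) ℓ
    respects-≈   : ∀ {π ρ} → π Perm.≈ ρ → Member π → Member ρ
    automorphism : ∀ {π} → Member π → IsAutomorphism X π
    id-closed    : Member Perm.id
    ∘-closed     : ∀ {π ρ} → Member π → Member ρ → Member (π ∘ₚ ρ)
    flip-closed  : ∀ {π} → Member π → Member (Perm.flip π)

IsTransitiveOn : {X : SimplicialComplex v} → AutomorphismGroup X ℓ → ℕ → Set ℓ
IsTransitiveOn {X = X} G n =
  ∀ σ τ → IsFace X (suc n) σ → IsFace X (suc n) τ →
  ∃ λ π → AutomorphismGroup.Member G π × π • σ ≡ τ

module _ (X : SimplicialComplex v) where

  -- The index i stands for the i-th element of faces X s.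

  FaceIndex : ℕ → Set
  FaceIndex s = Fin (length (faces X s))

  face : ∀ {s} → FaceIndex s → Subset v
  face {s} = List.lookup (faces X s)

  -- τ is a codimension-one face of σ.

  facet : ∀ {s} → FaceIndex s → FaceIndex (suc s) → Bool
  facet τ σ = does (face τ ⊆? face σ)

  -- C_k(X) = Chain (suc k) and C^k(X) = Cochain (suc k).

  Chain : ℕ → Set
  Chain s = Subset (length (faces X s))

  Cochain : ℕ → Set
  Cochain s = Vec Bool (length (faces X s))

  ∂ : ∀ {s} → Chain (suc s) → Chain s
  ∂ A = tabulate λ τ → sum₂ λ σ → Vec.lookup A σ ∧ facet τ σ

  d : ∀ {s} → Cochain s → Cochain (suc s)
  d φ = tabulate λ σ → sum₂ λ τ → facet τ σ ∧ Vec.lookup φ τ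

  IsCycle IsBoundary : ∀ k → Pred (Chain (suc k)) 0ℓ
  IsCycle    k A = ∂ A ≡ ⊥
  IsBoundary k B = ∃ λ (A : Chain (suc (suc k))) → ∂ A ≡ B

  IsCoboundary : ∀ k → Pred (Cochain (suc k)) 0ℓ
  IsCoboundary k φ = ∃ λ (ψ : Cochain k) → d ψ ≡ φ

  isCycle? : ∀ k → Decidable (IsCycle k)
  isCycle? k A = ∂ A ≟ₛ ⊥

  isBoundary? : ∀ k → Decidable (IsBoundary k)
  isBoundary? k B = anySubset? λ A → ∂ A ≟ₛ B

  isCoboundary? : ∀ k → Decidable (IsCoboundary k)
  isCoboundary? k φ = anySubset? λ ψ → d ψ ≟ₛ φ

  allChains : ∀ s → List (Chain s)
  allChains s = allSubsets _

  allCochains : ∀ s → List (Cochain s)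
  allCochains s = allSubsets _

  open Extrema ℕ∞-totalOrder using () renaming (min to min∞; max to max∞)
  open Extrema ℚ∞-totalOrder using () renaming (min to minℚ∞)
  open Extrema ℚ-totalOrder using () renaming (min to minℚ)

  size : ∀ {s} → Chain s → ℕ∞
  size A = [ ∣ A ∣ ]

  Sys : ℕ → ℕ∞
  Sys k = min∞ ⊤⁺ (List.map size
    (filter (isCycle? k ∩? ∁? (isBoundary? k)) (allChains (suc k))))

  -- The minimum of the empty set being ∞, this also covers B ∉ B_k.

  FillChain : ∀ k → Chain (suc k) → ℕ∞
  FillChain k B = min∞ ⊤⁺ (List.map size
    (filter (λ A → ∂ A ≟ₛ B) (allChains (suc (suc k)))))

  -- The zero chain is always a competitor, so the default value 0 is harmless.

  Fill : ℕ → ℕ∞ → ℕ∞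
  Fill k m = max∞ [ 0 ] (List.map (FillChain k)
    (filter (isCycle? k ∩? (λ B → ℕ≤.≤⁺-dec ℕ._≤?_ (size B) m)) (allChains (suc k))))

  -- Shifted index: M₋₁₊ i is M_{i−1}.

  M₋₁₊ : ℕ → ℕ∞
  M₋₁₊ zero    = [ 1 ]
  M₋₁₊ (suc k) = Fill k (suc k ·∞ M₋₁₊ k +∞ 1)

  -- The weights below are those of X as an n-dimensional complex.

  module _ (n : ℕ) where

    weight : ∀ {s} → FaceIndex s → ℚ
    weight {s} τ =
      fromℕ (length (filter (face τ ⊆?_) (faces X (suc n))))
        ÷₀ fromℕ ((suc n C s) ℕ.* length (faces X (suc n)))

    w : ∀ {s} → Cochain s → ℚ
    w φ = sumℚ λ τ → if Vec.lookup φ τ then weight τ else 0ℚ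

    -- The default value w φ is the one at ψ = 0 ∈ B^k.

    distance : ∀ k → Cochain (suc k) → ℚ
    distance k φ = minℚ (w φ) (List.map (λ ψ → w (zipWith _xor_ φ ψ))
      (filter (isCoboundary? k) (allCochains (suc k))))

    Exp : ℕ → ℚ∞
    Exp k = minℚ∞ ⊤⁺ (List.map (λ φ → [ w (d φ) ÷₀ distance k φ ])
      (filter (∁? (isCoboundary? k)) (allCochains (suc k))))

-- Over 𝔽₂, fill the cycles τ + c(∂τ) one dimension after the other: the systolic hypothesis makes each
-- of them a boundary, and the filling bounds |c(τ)| by M.  The resulting chain contraction c gives
-- φ + d(φ ∘ c) = dφ ∘ c, so the distance of φ to the coboundaries is at most the weight of
-- {τ : dφ(c τ) = 1}.  Replace c by g c g⁻¹ and average over all automorphisms g: by transitivity, the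
-- image of a fixed face ρ under a random g lies in supp dφ with probability at most h / |X(n)|, where h
-- is the number of n-faces that contain some member of supp dφ.  Since dφ is a cocycle, such an n-face
-- contains at least n − k members, hence (n − k) h ≤ Σ { deg β : β ∈ supp dφ }, and
-- (k + 2) C(n+1, k+2) = (n − k) C(n+1, k+1) turns this into the constant C(n+1, k+1).

module Submission where

open import Defs
open import Algebra.Bundles using (CommutativeRing)
import Algebra.Properties.Semiring.Sum as SemiringSum
open import Data.Bool.Base using (Bool; true; false; not; _∧_; _xor_; if_then_else_)
import Data.Bool.Properties as Bool
open import Data.Fin.Base using (Fin; zero; suc; punchOut)
open import Data.Fin.Permutation as Perm
  using (Permutation′; permutation; _⟨$⟩ˡ_; _⟨$⟩ʳ_)
import Data.Fin.Properties as Fin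
open import Data.Fin.Subset
  using (Subset; inside; outside; ⊥; _∈_; _∉_; _⊆_; ∣_∣)
open import Data.Fin.Subset.Properties
  using (_∈?_; _⊆?_; ⊆-min; ⊆-trans; drop-∷-⊆; p⊆q⇒∣p∣≤∣q∣; ∣⊥∣≡0; ∣⁅x⁆∣≡1; anySubset?)
import Data.Integer.Base as ℤ
import Data.Integer.Properties as ℤ
open import Data.List.Base as List using (List; []; _∷_; _++_; filter; length)
import Data.List.Extrema as Extrema
open import Data.List.Membership.Propositional using () renaming (_∈_ to _∈ₗ_)
open import Data.List.Membership.Propositional.Properties
  using (∈-lookup; ∈-filter⁺; ∈-filter⁻; ∈-map⁺; ∈-map⁻; ∈-++⁺ˡ; ∈-++⁺ʳ)
open import Data.List.Relation.Unary.All as All using ()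
open import Data.List.Relation.Unary.AllPairs using ([]; _∷_)
open import Data.List.Relation.Unary.Any as Any using (index)
open import Data.List.Relation.Unary.Any.Properties using (lookup-index)
open import Data.List.Relation.Unary.Unique.Propositional using (Unique)
import Data.List.Relation.Unary.Unique.Propositional.Properties as Unique
open import Data.Nat.Base as ℕ
  using (ℕ; zero; suc; _+_; _*_; _∸_; _<_; _≤_; z≤n; s≤s)
open import Data.Nat.Combinatorics
  using (_C_; nC1≡n; nCk≡nC[n∸k]; k>n⇒nCk≡0; nCk+nC[k+1]≡[n+1]C[k+1])
import Data.Nat.Coprimality as Coprimality
import Data.Nat.ListAction as ListAction
import Data.Nat.Properties as ℕ
open import Data.Nat.Solver using (module +-*-Solver)
open import Data.Product.Base using (∃; _×_; _,_; proj₁; proj₂)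
open import Data.Rational.Base as ℚ using (ℚ; 0ℚ; 1ℚ; mkℚ)
import Data.Rational.Properties as ℚ
open import Data.Sum.Base using (_⊎_; inj₁; inj₂; [_,_]′)
open import Data.Vec.Base as Vec using (Vec; []; _∷_; lookup; tabulate; _[_]≔_)
import Data.Vec.Properties as Vec
open import Function.Base using (_∘_; id)
open import Function.Bundles using (Equivalence; mk⇔)
open import Function.Definitions using (Injective)
open import Level using (0ℓ)
open import Relation.Binary.Bundles using (TotalOrder)
import Relation.Binary.Construct.Add.Supremum.NonStrict as NonStrict
import Relation.Binary.Construct.Add.Supremum.Strict as Strict
open import Relation.Binary.PropositionalEquality
open import Relation.Nullary using (¬_; Dec; yes; no; does; contradiction)
open import Relation.Nullary.Construct.Add.Supremum using ([_]; ⊤⁺)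
open import Relation.Nullary.Decidable
  using (dec-true; dec-false; decidable-stable; does-⇔; map′; ¬?; _×-dec_; _→-dec_)
open import Relation.Unary using (Pred; Decidable)
open import Relation.Unary.Properties using (_∩?_; ∁?)

open SemiringSum ℕ.+-*-semiring
open SemiringSum (CommutativeRing.semiring Bool.xor-∧-commutativeRing)
  using () renaming
  ( sum to sum₂; sum-cong-≗ to sum₂-cong; ∑-distrib-+ to sum₂-distrib-xor; ∑-comm to sum₂-comm
  ; *-distribˡ-sum to ∧-distribˡ-sum₂; *-distribʳ-sum to ∧-distribʳ-sum₂
  ; sum-replicate-zero to sum₂-false; sum-permute to sum₂-permute)
open SemiringSum (CommutativeRing.semiring ℚ.+-*-commutativeRing)
  using () renaming (sum to sumℚ; sum-cong-≗ to sumℚ-cong; *-distribʳ-sum to *-distribʳ-sumℚ)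
open NonStrict ℕ._≤_ using ([_]) renaming (_≤⁺_ to _≤∞_)
open Strict ℕ._<_ using ([_])

-- The argument (j+1) M_{j-1} + 1 of `Fill` bounds the size of the cycle to be filled: a j-face
-- contributes itself, and each of its j+1 facets is coned by at most M_{j-1} faces. Staying below
-- the systole makes these cycles bound and also keeps M_j finite.
--
-- The obstacle is that the group is transitive on n-faces only, so nothing is known about how often
-- a (k+1)-face ρ of c(τ) is carried to a given face. Purity supplies an n-face σ above ρ, and the
-- event that gρ lies in supp dφ is enlarged to the event that gσ contains some member of supp dφ;
-- the latter has probability exactly h / |X(n)|. Averaging is legitimate because the distance of φ
-- to the coboundaries is one number that lies below the estimate for every g.
--
-- The crude count h ≤ Σ deg β would end with C(n+1, k+2) in place of C(n+1, k+1). Counting n - k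
-- members in each n-face that is hit repairs this, even with a factor k + 2 to spare.
--
-- A degree is a weight with its denominator cleared, so the counting takes place in ℕ, and
-- rationals enter only for the comparison with `Exp`.

bit : Bool → ℕ
bit b = if b then 1 else 0

odd : ℕ → Bool
odd zero    = false
odd (suc n) = not (odd n)

bit-∧ : ∀ a b → bit (a ∧ b) ≡ bit a * bit b
bit-∧ false b = refl
bit-∧ true  b = sym (ℕ.+-identityʳ (bit b))

bit-xor≤ : ∀ a b → bit (a xor b) ≤ bit a + bit b
bit-xor≤ false b     = ℕ.≤-refl
bit-xor≤ true  false = ℕ.≤-refl
bit-xor≤ true  true  = z≤n

sum-mono : ∀ {n} {f g : Fin n → ℕ} → (∀ i → f i ≤ g i) → sum f ≤ sum g
sum-mono {zero}  f≤g = z≤n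
sum-mono {suc n} f≤g = ℕ.+-mono-≤ (f≤g zero) (sum-mono (f≤g ∘ suc))

term≤sum : ∀ {n} (f : Fin n → ℕ) i → f i ≤ sum f
term≤sum f zero    = ℕ.m≤m+n _ _
term≤sum f (suc i) = ℕ.≤-trans (term≤sum (f ∘ suc) i) (ℕ.m≤n+m _ _)

sum-mono-< : ∀ {n} {f g : Fin n → ℕ} → (∀ i → f i ≤ g i) → ∀ i → f i < g i → sum f < sum g
sum-mono-< f≤g zero    fi<gi = ℕ.+-mono-<-≤ fi<gi (sum-mono (f≤g ∘ suc))
sum-mono-< f≤g (suc i) fi<gi = ℕ.+-mono-≤-< (f≤g zero) (sum-mono-< (f≤g ∘ suc) i fi<gi)

sum-const : ∀ n c → sum {n} (λ _ → c) ≡ n * c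
sum-const zero    c = refl
sum-const (suc n) c = cong (c +_) (sum-const n c)

sum₂-zero : ∀ {n} {f : Fin n → Bool} → (∀ i → f i ≡ false) → sum₂ f ≡ false
sum₂-zero {n} f≡0 = trans (sum₂-cong f≡0) (sum₂-false n)

sum₂-odd : ∀ {n} (f : Fin n → Bool) → sum₂ f ≡ odd (sum (bit ∘ f))
sum₂-odd {zero}  f = refl
sum₂-odd {suc n} f with f zero
... | false = sum₂-odd (f ∘ suc)
... | true  = cong not (sum₂-odd (f ∘ suc))

bit-sum₂≤ : ∀ {n} (f : Fin n → Bool) → bit (sum₂ f) ≤ sum (bit ∘ f)
bit-sum₂≤ {zero}  f = z≤n
bit-sum₂≤ {suc n} f = ℕ.≤-trans (bit-xor≤ (f zero) _) (ℕ.+-monoʳ-≤ _ (bit-sum₂≤ (f ∘ suc)))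

sum₂-single : ∀ {n} (f : Fin n → Bool) i → (∀ j → j ≢ i → f j ≡ false) → sum₂ f ≡ f i
sum₂-single f zero    off = trans (cong (f zero xor_) (sum₂-zero λ j → off (suc j) λ ())) (Bool.xor-identityʳ _)
sum₂-single f (suc i) off = trans (cong (_xor sum₂ (f ∘ suc)) (off zero λ ()))
  (sum₂-single (f ∘ suc) i λ j j≢i → off (suc j) (j≢i ∘ Fin.suc-injective))

sum₂-false⇒another : ∀ {n} (f : Fin n → Bool) i → sum₂ f ≡ false → f i ≡ true →
  ∃ λ j → j ≢ i × f j ≡ true
sum₂-false⇒another f i ∑f≡0 fi with Fin.any? (λ j → ¬? (j Fin.≟ i) ×-dec (f j Bool.≟ true))
... | yes p = p
... | no ¬p = contradiction
  (trans (sym fi) (trans (sym (sum₂-single f i λ j j≢i → Bool.¬-not λ fj → ¬p (j , j≢i , fj))) ∑f≡0)) λ ()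

∣∣≡sum : ∀ {n} (p : Subset n) → ∣ p ∣ ≡ sum (bit ∘ lookup p)
∣∣≡sum []            = refl
∣∣≡sum (inside  ∷ p) = cong suc (∣∣≡sum p)
∣∣≡sum (outside ∷ p) = ∣∣≡sum p

-- Sums over lists of subsets, and the ranks of Boolean intervals

sumₗ : ∀ {a} {A : Set a} → (A → ℕ) → List A → ℕ
sumₗ f xs = ListAction.sum (List.map f xs)

module _ {a} {A : Set a} where

  sum-lookup : ∀ (f : A → ℕ) xs → sum (f ∘ List.lookup xs) ≡ sumₗ f xs
  sum-lookup f []       = refl
  sum-lookup f (x ∷ xs) = cong (f x +_) (sum-lookup f xs)

  sumₗ-cong : ∀ {f g : A → ℕ} → f ≗ g → ∀ xs → sumₗ f xs ≡ sumₗ g xs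
  sumₗ-cong f≗g []       = refl
  sumₗ-cong f≗g (x ∷ xs) = cong₂ _+_ (f≗g x) (sumₗ-cong f≗g xs)

  sumₗ-zero : ∀ {f : A → ℕ} → (∀ x → f x ≡ 0) → ∀ xs → sumₗ f xs ≡ 0
  sumₗ-zero f≡0 []       = refl
  sumₗ-zero f≡0 (x ∷ xs) = cong₂ _+_ (f≡0 x) (sumₗ-zero f≡0 xs)

  sumₗ-filter : ∀ {p} {P : Pred A p} (P? : Decidable P) f xs →
    sumₗ f (filter P? xs) ≡ sumₗ (λ x → bit (does (P? x)) * f x) xs
  sumₗ-filter P? f [] = refl
  sumₗ-filter P? f (x ∷ xs) with does (P? x)
  ... | false = sumₗ-filter P? f xs
  ... | true  = cong₂ _+_ (sym (ℕ.+-identityʳ (f x))) (sumₗ-filter P? f xs)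

  sumₗ-++ : ∀ (f : A → ℕ) xs ys → sumₗ f (xs ++ ys) ≡ sumₗ f xs + sumₗ f ys
  sumₗ-++ f []       ys = refl
  sumₗ-++ f (x ∷ xs) ys = trans (cong (f x +_) (sumₗ-++ f xs ys)) (sym (ℕ.+-assoc (f x) _ _))

  length-filter≡sum : ∀ {p} {P : Pred A p} (P? : Decidable P) xs →
    length (filter P? xs) ≡ sum (bit ∘ does ∘ P? ∘ List.lookup xs)
  length-filter≡sum P? [] = refl
  length-filter≡sum P? (x ∷ xs) with does (P? x)
  ... | false = length-filter≡sum P? xs
  ... | true  = cong suc (length-filter≡sum P? xs)

sumₗ-map : ∀ {a b} {A : Set a} {B : Set b} (f : B → ℕ) (g : A → B) xs →
  sumₗ f (List.map g xs) ≡ sumₗ (f ∘ g) xs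
sumₗ-map f g []       = refl
sumₗ-map f g (x ∷ xs) = cong (f (g x) +_) (sumₗ-map f g xs)

sumₗ-allSubsets : ∀ {m} (f : Subset (suc m) → ℕ) →
  sumₗ f (allSubsets (suc m)) ≡
  sumₗ (f ∘ (outside ∷_)) (allSubsets m) + sumₗ (f ∘ (inside ∷_)) (allSubsets m)
sumₗ-allSubsets {m} f = trans (sumₗ-++ f (List.map (outside ∷_) (allSubsets m)) _)
  (cong₂ _+_ (sumₗ-map f (outside ∷_) (allSubsets m)) (sumₗ-map f (inside ∷_) (allSubsets m)))

-- The sum of f over the ranks of a Boolean lattice of rank d, i.e. Σᵢ (d C i) f i.
binomialSum : ℕ → (ℕ → ℕ) → ℕ
binomialSum zero    f = f 0
binomialSum (suc d) f = binomialSum d f + binomialSum d (f ∘ suc)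

binomialSum-cong : ∀ d {f g} → f ≗ g → binomialSum d f ≡ binomialSum d g
binomialSum-cong zero    f≗g = f≗g 0
binomialSum-cong (suc d) f≗g = cong₂ _+_ (binomialSum-cong d f≗g) (binomialSum-cong d (f≗g ∘ suc))

binomialSum-zero : ∀ d → binomialSum d (λ _ → 0) ≡ 0
binomialSum-zero zero    = refl
binomialSum-zero (suc d) = cong₂ _+_ (binomialSum-zero d) (binomialSum-zero d)

binomialSum-δ : ∀ d r → binomialSum d (λ i → bit (does (i ℕ.≟ r))) ≡ d C r
binomialSum-δ zero    zero    = refl
binomialSum-δ zero    (suc r) = refl
binomialSum-δ (suc d) zero    = trans (cong₂ _+_ (binomialSum-δ d 0) (binomialSum-zero d)) (ℕ.+-identityʳ 1)
binomialSum-δ (suc d) (suc r) = trans (cong₂ _+_ (binomialSum-δ d (suc r)) (binomialSum-δ d r))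
  (trans (ℕ.+-comm (d C suc r) _) (nCk+nC[k+1]≡[n+1]C[k+1] d r))

_⊆ᵇ_ : ∀ {m} → Subset m → Subset m → Bool
p ⊆ᵇ q = does (p ⊆? q)

-- Only a vertex of `μ` outside `τ` leaves `ρ` a choice. There are `d` such vertices, so the sum
-- splits `d` times, in the way `binomialSum` does.
interval-sum : ∀ {m} {τ μ : Subset m} d (f : ℕ → ℕ) → τ ⊆ μ → ∣ μ ∣ ≡ d + ∣ τ ∣ →
  sumₗ (λ ρ → bit (τ ⊆ᵇ ρ ∧ ρ ⊆ᵇ μ) * f ∣ ρ ∣) (allSubsets m) ≡ binomialSum d (λ i → f (i + ∣ τ ∣))
interval-sum {τ = []} {[]} zero f τ⊆μ eq = trans (ℕ.+-identityʳ _) (ℕ.+-identityʳ _)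
interval-sum {suc m} {outside ∷ τ} {outside ∷ μ} d f τ⊆μ eq = trans (sumₗ-allSubsets {m} _) (trans
  (cong₂ _+_ (interval-sum d f (drop-∷-⊆ τ⊆μ) eq)
    (sumₗ-zero (λ ρ → cong (λ b → bit b * _) (Bool.∧-zeroʳ (τ ⊆ᵇ ρ))) (allSubsets m)))
  (ℕ.+-identityʳ _))
interval-sum {suc m} {outside ∷ τ} {inside ∷ μ} zero f τ⊆μ eq =
  contradiction (ℕ.≤-trans (ℕ.≤-reflexive eq) (p⊆q⇒∣p∣≤∣q∣ (drop-∷-⊆ τ⊆μ))) (ℕ.<-irrefl refl)
interval-sum {suc m} {outside ∷ τ} {inside ∷ μ} (suc d) f τ⊆μ eq = trans (sumₗ-allSubsets {m} _)
  (cong₂ _+_ (interval-sum d f (drop-∷-⊆ τ⊆μ) (ℕ.suc-injective eq))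
             (interval-sum d (f ∘ suc) (drop-∷-⊆ τ⊆μ) (ℕ.suc-injective eq)))
interval-sum {suc m} {inside ∷ τ} {outside ∷ μ} d f τ⊆μ eq with () ← τ⊆μ Vec.here
interval-sum {suc m} {inside ∷ τ} {inside ∷ μ} d f τ⊆μ eq = trans (sumₗ-allSubsets {m} _) (trans
  (cong₂ _+_ (sumₗ-zero (λ ρ → refl) (allSubsets m))
    (interval-sum d (f ∘ suc) (drop-∷-⊆ τ⊆μ) (ℕ.suc-injective (trans eq (ℕ.+-suc d _)))))
  (binomialSum-cong d (λ i → cong f (sym (ℕ.+-suc i _)))))

∈-allSubsets : ∀ {m} (p : Subset m) → p ∈ₗ allSubsets m
∈-allSubsets []            = Any.here refl
∈-allSubsets (outside ∷ p) = ∈-++⁺ˡ (∈-map⁺ (outside ∷_) (∈-allSubsets p))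
∈-allSubsets (inside  ∷ p) = ∈-++⁺ʳ (List.map (outside ∷_) (allSubsets _)) (∈-map⁺ (inside ∷_) (∈-allSubsets p))

allSubsets-unique : ∀ m → Unique (allSubsets m)
allSubsets-unique zero    = All.[] ∷ []
allSubsets-unique (suc m) = Unique.++⁺
  (Unique.map⁺ Vec.∷-injectiveʳ (allSubsets-unique m)) (Unique.map⁺ Vec.∷-injectiveʳ (allSubsets-unique m))
  λ (p∈out , p∈in) → disjoint (∈-map⁻ _ p∈out) (∈-map⁻ _ p∈in)
  where
  disjoint : ∀ {p : Subset (suc m)} → (∃ λ q → q ∈ₗ allSubsets m × p ≡ outside ∷ q) →
             ¬ (∃ λ q → q ∈ₗ allSubsets m × p ≡ inside ∷ q)
  disjoint (_ , _ , refl) (_ , _ , ())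

lookup-injective : ∀ {a} {A : Set a} {xs : List A} → Unique xs →
  ∀ {i j} → List.lookup xs i ≡ List.lookup xs j → i ≡ j
lookup-injective (_   ∷ _)   {zero}  {zero}  eq = refl
lookup-injective (x∉  ∷ _)   {zero}  {suc j} eq = contradiction eq (All.lookup x∉ (∈-lookup j))
lookup-injective (x∉  ∷ _)   {suc i} {zero}  eq = contradiction (sym eq) (All.lookup x∉ (∈-lookup i))
lookup-injective (_   ∷ xs!) {suc i} {suc j} eq = cong suc (lookup-injective xs! eq)

⊆ᵇ-true : ∀ {m} {p q : Subset m} → p ⊆ q → p ⊆ᵇ q ≡ true
⊆ᵇ-true {p = p} {q} = dec-true (p ⊆? q)

⊆ᵇ-⊆ : ∀ {m} {p q : Subset m} → p ⊆ᵇ q ≡ true → p ⊆ q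
⊆ᵇ-⊆ {p = p} {q} eq with p ⊆? q
... | yes p⊆q = p⊆q

⊆-size⇒≡ : ∀ {m} {p q : Subset m} → p ⊆ q → ∣ p ∣ ≡ ∣ q ∣ → p ≡ q
⊆-size⇒≡ {p = []} {[]} p⊆q eq = refl
⊆-size⇒≡ {p = outside ∷ p} {outside ∷ q} p⊆q eq = cong (outside ∷_) (⊆-size⇒≡ (drop-∷-⊆ p⊆q) eq)
⊆-size⇒≡ {p = outside ∷ p} {inside ∷ q} p⊆q eq =
  contradiction (ℕ.≤-trans (ℕ.≤-reflexive (sym eq)) (p⊆q⇒∣p∣≤∣q∣ (drop-∷-⊆ p⊆q))) (ℕ.<-irrefl refl)
⊆-size⇒≡ {p = inside ∷ p} {outside ∷ q} p⊆q eq with () ← p⊆q Vec.here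
⊆-size⇒≡ {p = inside ∷ p} {inside ∷ q} p⊆q eq = cong (inside ∷_) (⊆-size⇒≡ (drop-∷-⊆ p⊆q) (ℕ.suc-injective eq))

-- Indexing and counting the faces of a complex

module _ {v} (X : SimplicialComplex v) where

  private
    T : ℕ → Set
    T = FaceIndex X

  face-isFace : ∀ {s} (i : T s) → IsFace X s (face X i)
  face-isFace {s} i = proj₂ (∈-filter⁻ (isFace? X s) {xs = allSubsets v} (∈-lookup {xs = faces X s} i))

  Face-face : ∀ {s} (i : T s) → Face X (face X i)
  Face-face i = proj₁ (face-isFace i)

  ∣face∣ : ∀ {s} (i : T s) → ∣ face X i ∣ ≡ s
  ∣face∣ i = proj₂ (face-isFace i)

  face-injective : ∀ {s} {i j : T s} → face X i ≡ face X j → i ≡ j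
  face-injective {s} = lookup-injective (Unique.filter⁺ (isFace? X s) (allSubsets-unique v))

  faceIndex : ∀ {s σ} → IsFace X s σ → T s
  faceIndex {s} {σ} f = index (∈-filter⁺ (isFace? X s) (∈-allSubsets σ) f)

  face-faceIndex : ∀ {s σ} (f : IsFace X s σ) → face X (faceIndex f) ≡ σ
  face-faceIndex {s} {σ} f = sym (lookup-index (∈-filter⁺ (isFace? X s) (∈-allSubsets σ) f))

  interval-count : ∀ {τ μ} d r → Face X μ → τ ⊆ μ → ∣ μ ∣ ≡ d + ∣ τ ∣ →
    sum (λ (ρ : T r) → bit (τ ⊆ᵇ face X ρ ∧ face X ρ ⊆ᵇ μ)) ≡
    binomialSum d (λ i → bit (does (i + ∣ τ ∣ ℕ.≟ r)))
  interval-count {τ} {μ} d r μ∈X τ⊆μ eq = begin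
    sum (λ (ρ : T r) → between (face X ρ))                       ≡⟨ sum-lookup between (faces X r) ⟩
    sumₗ between (faces X r)                                     ≡⟨ sumₗ-filter (isFace? X r) between (allSubsets v) ⟩
    sumₗ (λ ρ → bit (does (isFace? X r ρ)) * between ρ) (allSubsets v) ≡⟨ sumₗ-cong drop-Face? (allSubsets v) ⟩
    sumₗ (λ ρ → between ρ * bit (does (∣ ρ ∣ ℕ.≟ r))) (allSubsets v) ≡⟨ interval-sum d (λ i → bit (does (i ℕ.≟ r))) τ⊆μ eq ⟩
    binomialSum d (λ i → bit (does (i + ∣ τ ∣ ℕ.≟ r)))           ∎
    where
    open ≡-Reasoning
    between : Subset v → ℕ
    between ρ = bit (τ ⊆ᵇ ρ ∧ ρ ⊆ᵇ μ)
    drop-Face? : ∀ ρ → bit (does (isFace? X r ρ)) * between ρ ≡ between ρ * bit (does (∣ ρ ∣ ℕ.≟ r))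
    drop-Face? ρ with ρ ⊆? μ
    ... | no  _   rewrite Bool.∧-zeroʳ (τ ⊆ᵇ ρ) = ℕ.*-zeroʳ (bit (does (isFace? X r ρ)))
    ... | yes ρ⊆μ rewrite dec-true (Face? X ρ) (downward X ρ⊆μ μ∈X) = ℕ.*-comm (bit (does (∣ ρ ∣ ℕ.≟ r))) _

  subface-count : ∀ {μ m} r → Face X μ → ∣ μ ∣ ≡ m → sum (λ (ρ : T r) → bit (face X ρ ⊆ᵇ μ)) ≡ m C r
  subface-count {μ} {m} r μ∈X eq = begin
    sum (λ (ρ : T r) → bit (face X ρ ⊆ᵇ μ))
      ≡⟨ sum-cong-≗ (λ ρ → cong (λ b → bit (b ∧ face X ρ ⊆ᵇ μ)) (sym (⊆ᵇ-true (⊆-min (face X ρ))))) ⟩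
    sum (λ (ρ : T r) → bit (⊥ ⊆ᵇ face X ρ ∧ face X ρ ⊆ᵇ μ))
      ≡⟨ interval-count m r μ∈X (⊆-min μ) (trans eq (trans (sym (ℕ.+-identityʳ m)) (cong (m +_) (sym (∣⊥∣≡0 v))))) ⟩
    binomialSum m (λ i → bit (does (i + ∣ (⊥ {v}) ∣ ℕ.≟ r)))
      ≡⟨ binomialSum-cong m (λ i → cong (λ j → bit (does (j ℕ.≟ r))) (trans (cong (i +_) (∣⊥∣≡0 v)) (ℕ.+-identityʳ i))) ⟩
    binomialSum m (λ i → bit (does (i ℕ.≟ r)))
      ≡⟨ binomialSum-δ m r ⟩
    m C r ∎
    where open ≡-Reasoning

  -- If `τ ⊆ μ`, exactly two faces lie strictly between, the middle rank of a Boolean lattice of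
  -- rank 2; otherwise there are none. Both ∂∂ = 0 and dd = 0 come from this parity.
  facet∘facet : ∀ {s} (τ : T s) (μ : T (suc (suc s))) →
    sum₂ (λ ρ → facet X τ ρ ∧ facet X ρ μ) ≡ false
  facet∘facet {s} τ μ with face X τ ⊆? face X μ
  ... | no τ⊈μ = sum₂-zero λ ρ → Bool.¬-not λ eq →
    τ⊈μ (⊆-trans (⊆ᵇ-⊆ (Bool.∧-conicalˡ _ _ eq)) (⊆ᵇ-⊆ (Bool.∧-conicalʳ (facet X τ ρ) _ eq)))
  ... | yes τ⊆μ = trans (sum₂-odd λ ρ → facet X τ ρ ∧ facet X ρ μ) (cong odd (trans
    (interval-count 2 (suc s) (Face-face μ) τ⊆μ (trans (∣face∣ μ) (cong (2 +_) (sym (∣face∣ τ)))))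
    two))
    where
    two : binomialSum 2 (λ i → bit (does (i + ∣ face X τ ∣ ℕ.≟ suc s))) ≡ 2
    two rewrite ∣face∣ τ | dec-true (s ℕ.≟ s) refl | dec-false (s ℕ.≟ suc s) (ℕ.1+n≢n ∘ sym)
      | dec-false (suc s ℕ.≟ s) ℕ.1+n≢n = refl

-- Minima and maxima over filtered lists with a default value

module _ {a} {A : Set a} (O : TotalOrder 0ℓ 0ℓ 0ℓ) (f : A → TotalOrder.Carrier O)
  {p} {P : Pred A p} (P? : Decidable P) where

  open TotalOrder O using () renaming (_≤_ to _≼_)

  min-sel : ∀ ⊤ xs → let m = Extrema.min O ⊤ (List.map f (filter P? xs)) in
    m ≡ ⊤ ⊎ (∃ λ x → P x × m ≡ f x)
  min-sel ⊤ xs with Extrema.argmin-sel O id ⊤ (List.map f (filter P? xs))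
  ... | inj₁ min≡⊤ = inj₁ min≡⊤
  ... | inj₂ min∈ with ∈-map⁻ f min∈
  ... | x , x∈ , eq = inj₂ (x , proj₂ (∈-filter⁻ P? {xs = xs} x∈) , eq)

  ≤min : ∀ ⊤ xs {y} → y ≼ ⊤ → (∀ x → P x → y ≼ f x) → y ≼ Extrema.min O ⊤ (List.map f (filter P? xs))
  ≤min ⊤ xs {y} y≤⊤ y≤f = Extrema.v≤min⁺ O y≤⊤ (All.tabulate below)
    where
    below : ∀ {z} → z ∈ₗ List.map f (filter P? xs) → y ≼ z
    below z∈ with ∈-map⁻ f z∈
    ... | x , x∈ , refl = y≤f x (proj₂ (∈-filter⁻ P? {xs = xs} x∈))

  max-sel : ∀ ⊥ xs → let m = Extrema.max O ⊥ (List.map f (filter P? xs)) in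
    m ≡ ⊥ ⊎ (∃ λ x → P x × m ≡ f x)
  max-sel ⊥ xs with Extrema.argmax-sel O id ⊥ (List.map f (filter P? xs))
  ... | inj₁ max≡⊥ = inj₁ max≡⊥
  ... | inj₂ max∈ with ∈-map⁻ f max∈
  ... | x , x∈ , eq = inj₂ (x , proj₂ (∈-filter⁻ P? {xs = xs} x∈) , eq)

  min≤ : ∀ ⊤ {xs x} → x ∈ₗ xs → P x → Extrema.min O ⊤ (List.map f (filter P? xs)) ≼ f x
  min≤ ⊤ x∈xs Px = All.lookup (Extrema.min≤xs O ⊤ _) (∈-map⁺ f (∈-filter⁺ P? x∈xs Px))

  ≤max : ∀ ⊥ {xs x} → x ∈ₗ xs → P x → f x ≼ Extrema.max O ⊥ (List.map f (filter P? xs))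
  ≤max ⊥ x∈xs Px = All.lookup (Extrema.xs≤max O ⊥ _) (∈-map⁺ f (∈-filter⁺ P? x∈xs Px))

≤∞∧<∞⇒≱∞ : ∀ {x y z} → x ≤∞ y → y <∞ z → ¬ (z ≤∞ x)
≤∞∧<∞⇒≱∞ [ x≤y ] [ y<z ] [ z≤x ] = ℕ.<-irrefl refl (ℕ.<-≤-trans y<z (ℕ.≤-trans z≤x x≤y))

-- Systoles, fillings and the chain contraction

module _ {v} (X : SimplicialComplex v) where

  -- A cycle that does not bound would compete in `Sys` and force it down to `∣ B ∣`. Being a
  -- boundary is decidable by finite search, so refuting the negation suffices.
  cycle⇒boundary : ∀ {j m} (B : Chain X (suc j)) → IsCycle X j B → [ ∣ B ∣ ] ≤∞ m → m <∞ Sys X j →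
    IsBoundary X j B
  cycle⇒boundary {j} B ∂B≡0 ∣B∣≤m m<Sys = decidable-stable (isBoundary? X j B) λ B∉B →
    ≤∞∧<∞⇒≱∞ ∣B∣≤m m<Sys (min≤ ℕ∞-totalOrder (size X) (isCycle? X j ∩? ∁? (isBoundary? X j)) ⊤⁺
      (∈-allSubsets B) (∂B≡0 , B∉B))

  -- The given filling `A₀` competes in the minimum, which therefore cannot be the default `⊤⁺` and
  -- is the size of an actual chain.
  FillChain-attained : ∀ {j} (B : Chain X (suc j)) → IsBoundary X j B →
    ∃ λ A → ∂ X A ≡ B × FillChain X j B ≡ [ ∣ A ∣ ]
  FillChain-attained {j} B (A₀ , ∂A₀≡B) =
    [ (λ Fill≡⊤ → contradiction (subst (_≤∞ [ ∣ A₀ ∣ ]) Fill≡⊤ Fill≤) λ ()) , id ]′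
    (min-sel ℕ∞-totalOrder (size X) (λ A → ∂ X A ≟ₛ B) ⊤⁺ (allChains X (suc (suc j))))
    where
    Fill≤ : FillChain X j B ≤∞ [ ∣ A₀ ∣ ]
    Fill≤ = min≤ ℕ∞-totalOrder (size X) (λ A → ∂ X A ≟ₛ B) ⊤⁺ (∈-allSubsets A₀) ∂A₀≡B

  private
    short? : ∀ {j} m → Decidable (λ (B : Chain X (suc j)) → size X B ≤∞ m)
    short? m B = ℕ≤.≤⁺-dec ℕ._≤?_ (size X B) m

  FillChain≤Fill : ∀ {j m} (B : Chain X (suc j)) → IsCycle X j B → [ ∣ B ∣ ] ≤∞ m →
    FillChain X j B ≤∞ Fill X j m
  FillChain≤Fill {j} {m} B ∂B≡0 ∣B∣≤m =
    ≤max ℕ∞-totalOrder (FillChain X j) (isCycle? X j ∩? short? m) [ 0 ] (∈-allSubsets B) (∂B≡0 , ∣B∣≤m)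

  -- Every cycle competing in the maximum is shorter than the systole, hence bounds and has a finite
  -- filling.
  Fill-finite : ∀ {j m} → m <∞ Sys X j → ∃ λ f → Fill X j m ≡ [ f ]
  Fill-finite {j} {m} m<Sys =
    [ (0 ,_)
    , (λ (B , (∂B≡0 , ∣B∣≤m) , Fill≡) →
        let A , _ , FillChain≡ = FillChain-attained B (cycle⇒boundary B ∂B≡0 ∣B∣≤m m<Sys)
        in ∣ A ∣ , trans Fill≡ FillChain≡)
    ]′ (max-sel ℕ∞-totalOrder (FillChain X j) (isCycle? X j ∩? short? m) [ 0 ] (allChains X (suc j)))

  private
    T : ℕ → Set
    T = FaceIndex X

  δ : ∀ {s} → T s → T s → Bool
  δ τ x = does (τ Fin.≟ x)

  δ-refl : ∀ {s} (x : T s) → δ x x ≡ true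
  δ-refl x = dec-true (x Fin.≟ x) refl

  δ-≢ : ∀ {s} {x y : T s} → x ≢ y → δ x y ≡ false
  δ-≢ {x = x} {y} = dec-false (x Fin.≟ y)

  sum₂-δ : ∀ {s} (f : T s → Bool) x → sum₂ (λ τ → f τ ∧ δ τ x) ≡ f x
  sum₂-δ f x = trans
    (sum₂-single _ x λ τ τ≢x → trans (cong (f τ ∧_) (δ-≢ τ≢x)) (Bool.∧-zeroʳ (f τ)))
    (trans (cong (f x ∧_) (δ-refl x)) (Bool.∧-identityʳ (f x)))

  sum₂-δ′ : ∀ {s} (f : T s → Bool) x → sum₂ (λ τ → δ x τ ∧ f τ) ≡ f x
  sum₂-δ′ f x = trans
    (sum₂-single _ x λ τ τ≢x → cong (_∧ f τ) (δ-≢ (τ≢x ∘ sym)))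
    (cong (_∧ f x) (δ-refl x))

  sum-δ : ∀ {s} (x : T s) → sum (λ τ → bit (δ x τ)) ≤ 1
  sum-δ {s} x = go x
    where
    go : ∀ {n} (i : Fin n) → sum (λ j → bit (does (i Fin.≟ j))) ≤ 1
    go {suc n} zero    = ℕ.≤-reflexive (cong suc (trans (sum-const n 0) (ℕ.*-zeroʳ n)))
    go {suc n} (suc i) = go i

  -- ∂ (c τ) = τ + b τ and b (∂ μ) = 0.  In step-cone b τ = c (∂ τ), i.e. c is a chain contraction.
  record Cone (s : ℕ) (m : ℕ) : Set where
    field
      c        : T s → T (suc s) → Bool
      b        : T s → T s → Bool
      homotopy : ∀ τ x → sum₂ (λ ρ → c τ ρ ∧ facet X x ρ) ≡ δ τ x xor b τ x
      b-∂      : ∀ μ x → sum₂ (λ τ → facet X τ μ ∧ b τ x) ≡ false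
      small    : ∀ τ → sum (bit ∘ c τ) ≤ m

  coneBase : ∀ {s m} → Cone s m → T (suc s) → T (suc s) → Bool
  coneBase K μ x = sum₂ λ τ → facet X τ μ ∧ Cone.c K τ x

  facet-count : ∀ {s} (μ : T (suc s)) → sum (λ τ → bit (facet X τ μ)) ≡ suc s
  facet-count {s} μ = trans (subface-count X s (Face-face X μ) (∣face∣ X μ))
    (trans (nCk≡nC[n∸k] (ℕ.n≤1+n s)) (trans (cong (suc s C_) (ℕ.m+n∸n≡m 1 s)) (nC1≡n (suc s))))

  -- The chain filled over `μ` is z = μ + c(∂μ). It is a cycle since ∂c(∂μ) = ∂μ + b(∂μ) = ∂μ, and
  -- its size is at most that of `μ` itself plus `m` for each of the `suc s` facets. Minimal
  -- fillings are chosen, so that `Fill` bounds them.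
  step-cone : ∀ {s m m′} (K : Cone s m) →
    (suc s ·∞ [ m ] +∞ 1) <∞ Sys X s → Fill X s (suc s ·∞ [ m ] +∞ 1) ≡ [ m′ ] →
    ∃ λ (K′ : Cone (suc s) m′) → ∀ μ x → Cone.b K′ μ x ≡ coneBase K μ x
  step-cone {s} {m} {m′} K m<Sys Fill≡ = record
    { c = λ μ → lookup (c′ μ)
    ; b = coneBase K
    ; homotopy = λ μ x → trans (sym (Vec.lookup∘tabulate _ x))
        (trans (cong (λ A → lookup A x) (∂c′ μ)) (Vec.lookup∘tabulate _ x))
    ; b-∂ = b′-∂
    ; small = λ μ → subst (_≤ m′) (∣∣≡sum (c′ μ)) (c′-small μ)
    } , λ μ x → refl
    where
    open Cone K

    z : (μ : T (suc s)) → Chain X (suc s)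
    z μ = tabulate λ x → δ μ x xor coneBase K μ x

    -- This is c(∂∂ν) = 0: once the sums are exchanged, the inner one runs over the faces between
    -- `τ` and `ν`.
    b′-∂ : ∀ ν x → sum₂ (λ μ → facet X μ ν ∧ coneBase K μ x) ≡ false
    b′-∂ ν x = begin
      sum₂ (λ μ → facet X μ ν ∧ sum₂ λ τ → facet X τ μ ∧ c τ x)   ≡⟨ sum₂-cong (λ μ → ∧-distribˡ-sum₂ (facet X μ ν) (λ τ → facet X τ μ ∧ c τ x)) ⟩
      sum₂ (λ μ → sum₂ λ τ → facet X μ ν ∧ facet X τ μ ∧ c τ x)   ≡⟨ sum₂-comm (λ μ τ → facet X μ ν ∧ facet X τ μ ∧ c τ x) ⟩
      sum₂ (λ τ → sum₂ λ μ → facet X μ ν ∧ facet X τ μ ∧ c τ x)   ≡⟨ sum₂-zero vanish ⟩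
      false ∎
      where
      open ≡-Reasoning
      vanish : ∀ τ → sum₂ (λ μ → facet X μ ν ∧ facet X τ μ ∧ c τ x) ≡ false
      vanish τ = begin
        sum₂ (λ μ → facet X μ ν ∧ facet X τ μ ∧ c τ x)   ≡⟨ sum₂-cong (λ μ → sym (Bool.∧-assoc (facet X μ ν) _ _)) ⟩
        sum₂ (λ μ → (facet X μ ν ∧ facet X τ μ) ∧ c τ x) ≡⟨ sum₂-cong (λ μ → cong (_∧ c τ x) (Bool.∧-comm (facet X μ ν) _)) ⟩
        sum₂ (λ μ → (facet X τ μ ∧ facet X μ ν) ∧ c τ x) ≡⟨ ∧-distribʳ-sum₂ (c τ x) (λ μ → facet X τ μ ∧ facet X μ ν) ⟨
        sum₂ (λ μ → facet X τ μ ∧ facet X μ ν) ∧ c τ x   ≡⟨ cong (_∧ c τ x) (facet∘facet X τ ν) ⟩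
        false ∎

    -- Apply `homotopy` to each facet `σ` of `μ`; the contributions of `b` add up to b(∂μ), which
    -- vanishes.
    ∂-coneBase : ∀ μ τ → sum₂ (λ x → coneBase K μ x ∧ facet X τ x) ≡ facet X τ μ
    ∂-coneBase μ τ = begin
      sum₂ (λ x → coneBase K μ x ∧ facet X τ x)
        ≡⟨ sum₂-cong (λ x → ∧-distribʳ-sum₂ (facet X τ x) (λ σ → facet X σ μ ∧ c σ x)) ⟩
      sum₂ (λ x → sum₂ λ σ → (facet X σ μ ∧ c σ x) ∧ facet X τ x)
        ≡⟨ sum₂-comm (λ x σ → (facet X σ μ ∧ c σ x) ∧ facet X τ x) ⟩
      sum₂ (λ σ → sum₂ λ x → (facet X σ μ ∧ c σ x) ∧ facet X τ x)
        ≡⟨ sum₂-cong (λ σ → trans (sum₂-cong λ x → Bool.∧-assoc (facet X σ μ) (c σ x) (facet X τ x))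
                                    (sym (∧-distribˡ-sum₂ (facet X σ μ) (λ x → c σ x ∧ facet X τ x)))) ⟩
      sum₂ (λ σ → facet X σ μ ∧ sum₂ λ x → c σ x ∧ facet X τ x)
        ≡⟨ sum₂-cong (λ σ → trans (cong (facet X σ μ ∧_) (homotopy σ τ)) (Bool.∧-distribˡ-xor (facet X σ μ) _ _)) ⟩
      sum₂ (λ σ → (facet X σ μ ∧ δ σ τ) xor (facet X σ μ ∧ b σ τ))
        ≡⟨ sum₂-distrib-xor (λ σ → facet X σ μ ∧ δ σ τ) _ ⟩
      sum₂ (λ σ → facet X σ μ ∧ δ σ τ) xor sum₂ (λ σ → facet X σ μ ∧ b σ τ)
        ≡⟨ cong₂ _xor_ (sum₂-δ (λ σ → facet X σ μ) τ) (b-∂ μ τ) ⟩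
      facet X τ μ xor false
        ≡⟨ Bool.xor-identityʳ _ ⟩
      facet X τ μ ∎
      where open ≡-Reasoning

    z-cycle : ∀ μ → IsCycle X s (z μ)
    z-cycle μ = trans (Vec.tabulate-cong λ τ → begin
      sum₂ (λ x → lookup (z μ) x ∧ facet X τ x)
        ≡⟨ sum₂-cong (λ x → trans (cong (_∧ facet X τ x) (Vec.lookup∘tabulate _ x)) (Bool.∧-distribʳ-xor (facet X τ x) (δ μ x) _)) ⟩
      sum₂ (λ x → (δ μ x ∧ facet X τ x) xor (coneBase K μ x ∧ facet X τ x))
        ≡⟨ sum₂-distrib-xor (λ x → δ μ x ∧ facet X τ x) _ ⟩
      sum₂ (λ x → δ μ x ∧ facet X τ x) xor sum₂ (λ x → coneBase K μ x ∧ facet X τ x)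
        ≡⟨ cong₂ _xor_ (sum₂-δ′ (facet X τ) μ) (∂-coneBase μ τ) ⟩
      facet X τ μ xor facet X τ μ
        ≡⟨ Bool.xor-same (facet X τ μ) ⟩
      false
        ≡⟨ Vec.lookup-replicate τ false ⟨
      lookup ⊥ τ ∎) (Vec.tabulate∘lookup ⊥)
      where open ≡-Reasoning

    coneBase-small : ∀ μ → sum (bit ∘ coneBase K μ) ≤ suc s * m
    coneBase-small μ = begin
      sum (bit ∘ coneBase K μ)
        ≤⟨ sum-mono (λ x → bit-sum₂≤ λ τ → facet X τ μ ∧ c τ x) ⟩
      sum (λ x → sum λ τ → bit (facet X τ μ ∧ c τ x))
        ≡⟨ ∑-comm (λ x τ → bit (facet X τ μ ∧ c τ x)) ⟩
      sum (λ τ → sum λ x → bit (facet X τ μ ∧ c τ x))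
        ≡⟨ sum-cong-≗ (λ τ → trans (sum-cong-≗ λ x → bit-∧ (facet X τ μ) (c τ x)) (sym (*-distribˡ-sum (bit (facet X τ μ)) (bit ∘ c τ)))) ⟩
      sum (λ τ → bit (facet X τ μ) * sum (bit ∘ c τ))
        ≤⟨ sum-mono (λ τ → ℕ.*-monoʳ-≤ (bit (facet X τ μ)) (small τ)) ⟩
      sum (λ τ → bit (facet X τ μ) * m)
        ≡⟨ *-distribʳ-sum m (λ τ → bit (facet X τ μ)) ⟨
      sum (λ τ → bit (facet X τ μ)) * m
        ≡⟨ cong (_* m) (facet-count μ) ⟩
      suc s * m ∎
      where open ℕ.≤-Reasoning

    z-small : ∀ μ → ∣ z μ ∣ ≤ suc s * m + 1
    z-small μ = begin
      ∣ z μ ∣                                                    ≡⟨ ∣∣≡sum (z μ) ⟩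
      sum (bit ∘ lookup (z μ))
        ≡⟨ sum-cong-≗ (λ x → cong bit (Vec.lookup∘tabulate (λ x → δ μ x xor coneBase K μ x) x)) ⟩
      sum (λ x → bit (δ μ x xor coneBase K μ x))                 ≤⟨ sum-mono (λ x → bit-xor≤ (δ μ x) _) ⟩
      sum (λ x → bit (δ μ x) + bit (coneBase K μ x))             ≡⟨ ∑-distrib-+ (λ x → bit (δ μ x)) _ ⟩
      sum (λ x → bit (δ μ x)) + sum (bit ∘ coneBase K μ)         ≤⟨ ℕ.+-mono-≤ (sum-δ μ) (coneBase-small μ) ⟩
      1 + suc s * m                                              ≡⟨ ℕ.+-comm 1 _ ⟩
      suc s * m + 1                                              ∎
      where open ℕ.≤-Reasoning

    filling : ∀ μ → ∃ λ A → ∂ X A ≡ z μ × FillChain X s (z μ) ≡ [ ∣ A ∣ ]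
    filling μ = FillChain-attained (z μ) (cycle⇒boundary (z μ) (z-cycle μ) [ z-small μ ] m<Sys)

    c′ : ∀ μ → Chain X (suc (suc s))
    c′ μ = proj₁ (filling μ)

    ∂c′ : ∀ μ → ∂ X (c′ μ) ≡ z μ
    ∂c′ μ = proj₁ (proj₂ (filling μ))

    c′-small : ∀ μ → ∣ c′ μ ∣ ≤ m′
    c′-small μ = ℕ≤.[≤]-injective
      (subst₂ _≤∞_ (proj₂ (proj₂ (filling μ))) Fill≡ (FillChain≤Fill (z μ) (z-cycle μ) [ z-small μ ]))

  apex-cone : T 1 → Cone 0 1
  apex-cone a = record
    { c = λ _ → δ a
    ; b = λ _ _ → false
    ; homotopy = λ τ x → trans (sum₂-δ′ (facet X x) a) (trans (⊆ᵇ-true (∅⊆ x))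
        (sym (trans (Bool.xor-identityʳ (δ τ x)) (trans (cong (δ τ) (∅-unique x τ)) (δ-refl τ)))))
    ; b-∂ = λ μ x → sum₂-zero λ τ → Bool.∧-zeroʳ (facet X τ μ)
    ; small = λ _ → sum-δ a
    }
    where
    ∅≡ : (τ : T 0) → face X τ ≡ ⊥
    ∅≡ τ = sym (⊆-size⇒≡ (⊆-min _) (trans (∣⊥∣≡0 v) (sym (∣face∣ X τ))))
    ∅-unique : (x τ : T 0) → x ≡ τ
    ∅-unique x τ = face-injective X (trans (∅≡ x) (sym (∅≡ τ)))
    ∅⊆ : (x : T 0) → face X x ⊆ face X a
    ∅⊆ x = subst (_⊆ face X a) (sym (∅≡ x)) (⊆-min _)

  -- The equation for `b` is handed on because the coboundary identity involves two consecutive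
  -- cones and needs them to be linked.
  extend-cone : ∀ {k m} → M₋₁₊ X k ≡ [ m ] → (suc k ·∞ M₋₁₊ X k +∞ 1) <∞ Sys X k → (K : Cone k m) →
    ∃ λ m′ → M₋₁₊ X (suc k) ≡ [ m′ ] × ∃ λ (K′ : Cone (suc k) m′) → ∀ μ x → Cone.b K′ μ x ≡ coneBase K μ x
  extend-cone {k} {m} M≡ M<Sys K =
    proj₁ finite , trans (cong (λ M → Fill X k (suc k ·∞ M +∞ 1)) M≡) (proj₂ finite) , step-cone K m<Sys (proj₂ finite)
    where
    m<Sys : (suc k ·∞ [ m ] +∞ 1) <∞ Sys X k
    m<Sys = subst (λ M → (suc k ·∞ M +∞ 1) <∞ Sys X k) M≡ M<Sys
    finite = Fill-finite m<Sys

  cone : T 1 → ∀ k → (∀ j → j < k → (suc j ·∞ M₋₁₊ X j +∞ 1) <∞ Sys X j) →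
    ∃ λ m → M₋₁₊ X k ≡ [ m ] × Cone k m
  cone a zero    sys = 1 , refl , apex-cone a
  cone a (suc k) sys =
    let m  , M≡  , K        = cone a k λ j j<k → sys j (ℕ.m<n⇒m<1+n j<k)
        m′ , M′≡ , K′ , _   = extend-cone M≡ (sys k (ℕ.n<1+n k)) K
    in m′ , M′≡ , K′

-- Sums over tables of maps, and permutations acting on subsets

injective⇒permutation : ∀ {n} (f : Fin n → Fin n) → Injective _≡_ _≡_ f →
  ∃ λ (π : Permutation′ n) → ∀ i → π ⟨$⟩ʳ i ≡ f i
injective⇒permutation f f-inj = permutation f (proj₁ ∘ preimage) (proj₂ ∘ preimage)
  (λ i → f-inj (proj₂ (preimage (f i)))) , λ _ → refl
  where
  surjective : ∀ {n} {f : Fin n → Fin n} → Injective _≡_ _≡_ f → ∀ y → ¬ (∀ x → f x ≢ y)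
  surjective {suc n} f-inj y fx≢y = ℕ.1+n≰n (Fin.injective⇒≤ {f = λ x → punchOut (fx≢y x ∘ sym)}
    λ {i} {j} → f-inj ∘ Fin.punchOut-injective (fx≢y i ∘ sym) (fx≢y j ∘ sym))
  preimage : ∀ y → ∃ λ x → f x ≡ y
  preimage y with Fin.any? (λ x → f x Fin.≟ y)
  ... | yes p = p
  ... | no ¬p = contradiction (λ x fx≡y → ¬p (x , fx≡y)) (surjective f-inj y)

allSubsets? : ∀ {m p} {P : Pred (Subset m) p} → Decidable P → Dec (∀ σ → P σ)
allSubsets? P? = map′ (λ ¬∃¬ σ → decidable-stable (P? σ) λ ¬Pσ → ¬∃¬ (σ , ¬Pσ)) (λ ∀P (σ , ¬Pσ) → ¬Pσ (∀P σ))
  (¬? (anySubset? (¬? ∘ P?)))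

module _ {m : ℕ} where

  -- A sum over all maps from `Fin l` to `Fin m`, given by their tables. Summing over automorphisms
  -- becomes summing over all tables with a 0-1 indicator.
  sumᵥ : ∀ {l} → (Vec (Fin m) l → ℕ) → ℕ
  sumᵥ {zero}  F = F []
  sumᵥ {suc l} F = sum λ i → sumᵥ (F ∘ (i ∷_))

  sumᵥ-cong : ∀ {l} {F H : Vec (Fin m) l → ℕ} → F ≗ H → sumᵥ F ≡ sumᵥ H
  sumᵥ-cong {zero}  F≗H = F≗H []
  sumᵥ-cong {suc l} F≗H = sum-cong-≗ λ i → sumᵥ-cong (F≗H ∘ (i ∷_))

  sumᵥ-mono : ∀ {l} {F H : Vec (Fin m) l → ℕ} → (∀ f → F f ≤ H f) → sumᵥ F ≤ sumᵥ H
  sumᵥ-mono {zero}  F≤H = F≤H []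
  sumᵥ-mono {suc l} F≤H = sum-mono λ i → sumᵥ-mono (F≤H ∘ (i ∷_))

  term≤sumᵥ : ∀ {l} (F : Vec (Fin m) l → ℕ) f → F f ≤ sumᵥ F
  term≤sumᵥ F []      = ℕ.≤-refl
  term≤sumᵥ F (i ∷ f) = ℕ.≤-trans (term≤sumᵥ (F ∘ (i ∷_)) f) (term≤sum (λ j → sumᵥ (F ∘ (j ∷_))) i)

  sumᵥ-distribʳ : ∀ {l} (F : Vec (Fin m) l → ℕ) c → sumᵥ F * c ≡ sumᵥ (λ f → F f * c)
  sumᵥ-distribʳ {zero}  F c = refl
  sumᵥ-distribʳ {suc l} F c = trans (*-distribʳ-sum c (λ i → sumᵥ (F ∘ (i ∷_))))
    (sum-cong-≗ λ i → sumᵥ-distribʳ (F ∘ (i ∷_)) c)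

  sumᵥ-sum-comm : ∀ {l n} (F : Vec (Fin m) l → Fin n → ℕ) →
    sumᵥ (λ f → sum (F f)) ≡ sum (λ j → sumᵥ λ f → F f j)
  sumᵥ-sum-comm {zero}  F = refl
  sumᵥ-sum-comm {suc l} F = trans (sum-cong-≗ λ i → sumᵥ-sum-comm (F ∘ (i ∷_)))
    (∑-comm (λ i j → sumᵥ λ f → F (i ∷ f) j))

  -- Composing every table with `π` merely reorders the tables, one entry at a time. This is the
  -- translation invariance behind the average over automorphisms.
  sumᵥ-permute : ∀ {l} (F : Vec (Fin m) l → ℕ) (π : Permutation′ m) →
    sumᵥ F ≡ sumᵥ (F ∘ Vec.map (π ⟨$⟩ʳ_))
  sumᵥ-permute {zero}  F π = refl
  sumᵥ-permute {suc l} F π = trans (sum-permute (λ i → sumᵥ (F ∘ (i ∷_))) π)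
    (sum-cong-≗ λ i → sumᵥ-permute (F ∘ ((π ⟨$⟩ʳ i) ∷_)) π)

module _ {m} (π : Permutation′ m) where

  lookup-• : ∀ σ y → lookup (π • σ) y ≡ lookup σ (π ⟨$⟩ˡ y)
  lookup-• σ y = Vec.lookup∘tabulate _ y

  ∣•∣ : ∀ σ → ∣ π • σ ∣ ≡ ∣ σ ∣
  ∣•∣ σ = begin
    ∣ π • σ ∣                                   ≡⟨ ∣∣≡sum (π • σ) ⟩
    sum (bit ∘ lookup (π • σ))                  ≡⟨ sum-cong-≗ (cong bit ∘ lookup-• σ) ⟩
    sum (bit ∘ lookup σ ∘ (π ⟨$⟩ˡ_))            ≡⟨ sum-permute (bit ∘ lookup σ) (Perm.flip π) ⟨
    sum (bit ∘ lookup σ)                        ≡⟨ ∣∣≡sum σ ⟨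
    ∣ σ ∣                                       ∎
    where open ≡-Reasoning

  •-mono : ∀ {σ τ} → σ ⊆ τ → π • σ ⊆ π • τ
  •-mono {σ} {τ} σ⊆τ {y} y∈ = Vec.lookup⇒[]= y (π • τ) (trans (lookup-• τ y)
    (Vec.[]=⇒lookup (σ⊆τ (Vec.lookup⇒[]= _ σ (trans (sym (lookup-• σ y)) (Vec.[]=⇒lookup y∈))))))

flip-• : ∀ {m} (π : Permutation′ m) σ → Perm.flip π • (π • σ) ≡ σ
flip-• π σ = trans
  (Vec.tabulate-cong λ y → trans (lookup-• π σ (π ⟨$⟩ʳ y)) (cong (lookup σ) (Perm.inverseˡ π)))
  (Vec.tabulate∘lookup σ)

•-reflects-⊆ : ∀ {m} (π : Permutation′ m) {σ τ} → π • σ ⊆ π • τ → σ ⊆ τ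
•-reflects-⊆ π {σ} {τ} π•σ⊆π•τ = subst₂ _⊆_ (flip-• π σ) (flip-• π τ) (•-mono (Perm.flip π) π•σ⊆π•τ)

•-injective : ∀ {m} (π : Permutation′ m) {σ τ} → π • σ ≡ π • τ → σ ≡ τ
•-injective π {σ} {τ} eq = trans (sym (flip-• π σ)) (trans (cong (Perm.flip π •_) eq) (flip-• π τ))

⊆ᵇ-• : ∀ {m} (π : Permutation′ m) σ τ → (π • σ) ⊆ᵇ (π • τ) ≡ σ ⊆ᵇ τ
⊆ᵇ-• π σ τ with σ ⊆? τ
... | yes σ⊆τ = ⊆ᵇ-true (•-mono π σ⊆τ)
... | no  σ⊈τ = dec-false (π • σ ⊆? π • τ) (σ⊈τ ∘ •-reflects-⊆ π)

_*•_ : ∀ {m} → Vec (Fin m) m → Subset m → Subset m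
f *• σ = tabulate λ y → lookup σ (lookup f y)

-- Automorphisms acting on faces and cochains, and averaging over them

module _ {v} (X : SimplicialComplex v) where

  private
    T : ℕ → Set
    T = FaceIndex X

  -- On functions rather than vectors, so that pulling a cochain back along an action is
  -- composition.
  dᶠ : ∀ {s} → (T s → Bool) → T (suc s) → Bool
  dᶠ φ ρ = sum₂ λ τ → facet X τ ρ ∧ φ τ

  -- The transpose of ∂c′(τ) = τ + c(∂τ): evaluate `φ` on both sides and exchange sums.
  cone-d : ∀ {s m m′} (K : Cone X s m) (K′ : Cone X (suc s) m′) →
    (∀ μ x → Cone.b K′ μ x ≡ coneBase X K μ x) → ∀ φ τ →
    sum₂ (λ ρ → Cone.c K′ τ ρ ∧ dᶠ φ ρ) ≡ φ τ xor dᶠ (λ σ → sum₂ λ x → Cone.c K σ x ∧ φ x) τ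
  cone-d K K′ b≡ φ τ = begin
    sum₂ (λ ρ → c′ τ ρ ∧ sum₂ λ x → facet X x ρ ∧ φ x)
      ≡⟨ sum₂-cong (λ ρ → ∧-distribˡ-sum₂ (c′ τ ρ) (λ x → facet X x ρ ∧ φ x)) ⟩
    sum₂ (λ ρ → sum₂ λ x → c′ τ ρ ∧ facet X x ρ ∧ φ x)
      ≡⟨ sum₂-comm (λ ρ x → c′ τ ρ ∧ facet X x ρ ∧ φ x) ⟩
    sum₂ (λ x → sum₂ λ ρ → c′ τ ρ ∧ facet X x ρ ∧ φ x)
      ≡⟨ sum₂-cong (λ x → trans (sum₂-cong λ ρ → sym (Bool.∧-assoc (c′ τ ρ) (facet X x ρ) (φ x)))
                                (sym (∧-distribʳ-sum₂ (φ x) (λ ρ → c′ τ ρ ∧ facet X x ρ)))) ⟩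
    sum₂ (λ x → sum₂ (λ ρ → c′ τ ρ ∧ facet X x ρ) ∧ φ x)
      ≡⟨ sum₂-cong (λ x → trans (cong (_∧ φ x) (trans (Cone.homotopy K′ τ x) (cong (δ X τ x xor_) (b≡ τ x))))
                                (Bool.∧-distribʳ-xor (φ x) (δ X τ x) (coneBase X K τ x))) ⟩
    sum₂ (λ x → (δ X τ x ∧ φ x) xor (coneBase X K τ x ∧ φ x))
      ≡⟨ sum₂-distrib-xor (λ x → δ X τ x ∧ φ x) _ ⟩
    sum₂ (λ x → δ X τ x ∧ φ x) xor sum₂ (λ x → coneBase X K τ x ∧ φ x)
      ≡⟨ cong₂ _xor_ (sum₂-δ′ X φ τ) base ⟩
    φ τ xor sum₂ (λ σ → facet X σ τ ∧ sum₂ λ x → c σ x ∧ φ x) ∎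
    where
    open ≡-Reasoning
    open Cone K using (c)
    open Cone K′ using () renaming (c to c′)
    base : sum₂ (λ x → coneBase X K τ x ∧ φ x) ≡ sum₂ (λ σ → facet X σ τ ∧ sum₂ λ x → c σ x ∧ φ x)
    base = begin
      sum₂ (λ x → sum₂ (λ σ → facet X σ τ ∧ c σ x) ∧ φ x)
        ≡⟨ sum₂-cong (λ x → ∧-distribʳ-sum₂ (φ x) (λ σ → facet X σ τ ∧ c σ x)) ⟩
      sum₂ (λ x → sum₂ λ σ → (facet X σ τ ∧ c σ x) ∧ φ x)
        ≡⟨ sum₂-comm (λ x σ → (facet X σ τ ∧ c σ x) ∧ φ x) ⟩
      sum₂ (λ σ → sum₂ λ x → (facet X σ τ ∧ c σ x) ∧ φ x)
        ≡⟨ sum₂-cong (λ σ → trans (sum₂-cong λ x → Bool.∧-assoc (facet X σ τ) (c σ x) (φ x))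
                                  (sym (∧-distribˡ-sum₂ (facet X σ τ) (λ x → c σ x ∧ φ x)))) ⟩
      sum₂ (λ σ → facet X σ τ ∧ sum₂ λ x → c σ x ∧ φ x) ∎

  -- f tabulates the inverse of the automorphism acting as f *•_, in line with the definition of _•_.
  -- As X is finite, mapping faces to faces suffices.
  IsAut : Vec (Fin v) v → Set
  IsAut f = (∀ i j → lookup f i ≡ lookup f j → i ≡ j) × (∀ σ → Face X σ → Face X (f *• σ))

  isAut? : Decidable IsAut
  isAut? f = Fin.all? (λ i → Fin.all? λ j → (lookup f i Fin.≟ lookup f j) →-dec (i Fin.≟ j))
    ×-dec allSubsets? (λ σ → Face? X σ →-dec Face? X (f *• σ))

  aut : Vec (Fin v) v → ℕ
  aut f = bit (does (isAut? f))

  module Action f (f-aut : IsAut f) where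

    private
      inverse-of-f : ∃ λ (π : Permutation′ v) → ∀ i → π ⟨$⟩ʳ i ≡ lookup f i
      inverse-of-f = injective⇒permutation (lookup f) (λ {i} {j} → proj₁ f-aut i j)

    π : Permutation′ v
    π = Perm.flip (proj₁ inverse-of-f)

    *•≡• : ∀ σ → f *• σ ≡ π • σ
    *•≡• σ = Vec.tabulate-cong λ y → cong (lookup σ) (sym (proj₂ inverse-of-f y))

    moved : ∀ {s} (i : T s) → IsFace X s (π • face X i)
    moved i = subst (Face X) (*•≡• (face X i)) (proj₂ f-aut _ (Face-face X i)) , trans (∣•∣ π (face X i)) (∣face∣ X i)

    private
      permutes : ∀ {s} → ∃ λ (P : Permutation′ (length (faces X s))) → ∀ i → P ⟨$⟩ʳ i ≡ faceIndex X (moved i)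
      permutes = injective⇒permutation _ λ {i} {j} eq → face-injective X (•-injective π
        (trans (sym (face-faceIndex X (moved i))) (trans (cong (face X) eq) (face-faceIndex X (moved j)))))

    P : ∀ {s} → Permutation′ (length (faces X s))
    P = proj₁ permutes

    act : ∀ {s} → T s → T s
    act = P ⟨$⟩ʳ_

    face-act : ∀ {s} (i : T s) → face X (act i) ≡ π • face X i
    face-act i = trans (cong (face X) (proj₂ permutes i)) (face-faceIndex X (moved i))

    ⊆ᵇ-act : ∀ {s t} (i : T s) (j : T t) → face X (act i) ⊆ᵇ face X (act j) ≡ face X i ⊆ᵇ face X j
    ⊆ᵇ-act i j = trans (cong₂ _⊆ᵇ_ (face-act i) (face-act j)) (⊆ᵇ-• π (face X i) (face X j))

    dᶠ-act : ∀ {s} (φ : T s → Bool) ρ → dᶠ φ (act ρ) ≡ dᶠ (φ ∘ act) ρ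
    dᶠ-act φ ρ = trans (sum₂-permute (λ τ → facet X τ (act ρ) ∧ φ τ) P)
      (sum₂-cong λ τ → cong (_∧ φ (act τ)) (⊆ᵇ-act τ ρ))

  module _ (n : ℕ) where

    -- Weights with the common denominator (n+1 C s) |X(n)| cleared.
    deg : ∀ {s} → T s → ℕ
    deg τ = sum λ (σ : T (suc n)) → bit (face X τ ⊆ᵇ face X σ)

    W : ∀ {s} → (T s → Bool) → ℕ
    W φ = sum λ τ → bit (φ τ) * deg τ

    module _ f (f-aut : IsAut f) where
      open Action f f-aut

      deg-act : ∀ {s} (τ : T s) → deg (act τ) ≡ deg τ
      deg-act τ = trans (sum-permute (λ σ → bit (face X (act τ) ⊆ᵇ face X σ)) P)
        (sum-cong-≗ λ σ → cong bit (⊆ᵇ-act τ σ))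

      W-act : ∀ {s} (φ : T s → Bool) → W (φ ∘ act) ≡ W φ
      W-act φ = sym (trans (sum-permute (λ τ → bit (φ τ) * deg τ) P)
        (sum-cong-≗ λ τ → cong (bit (φ (act τ)) *_) (deg-act τ)))

      -- Conjugating the cone by an automorphism amounts to keeping it fixed and pulling `φ` back.
      -- The identity `cone-d` for `φ ∘ act` yields the correction `ψ′`; moved back by the inverse
      -- action it becomes the competitor `ψ` for `D`, and `W` is invariant under the action.
      coboundary-distance-act : ∀ {s m m′} (K : Cone X s m) (K′ : Cone X (suc s) m′) →
        (∀ μ x → Cone.b K′ μ x ≡ coneBase X K μ x) →
        ∀ φ D → (∀ ψ → D ≤ W (λ τ → φ τ xor dᶠ ψ τ)) →
        D ≤ sum λ τ → deg τ * sum λ ρ → bit (Cone.c K′ τ ρ) * bit (dᶠ φ (act ρ))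
      coboundary-distance-act K K′ b≡ φ D D≤ = begin
        D ≤⟨ D≤ ψ ⟩
        W (λ τ → φ τ xor dᶠ ψ τ) ≡⟨ W-act (λ τ → φ τ xor dᶠ ψ τ) ⟨
        W (λ τ → φ (act τ) xor dᶠ ψ (act τ))
          ≡⟨ sum-cong-≗ (λ τ → cong (λ b → bit b * deg τ) (cong (φ (act τ) xor_) (trans (dᶠ-act ψ τ)
               (sum₂-cong λ σ → cong (facet X σ τ ∧_) (cong ψ′ (Perm.inverseˡ P)))))) ⟩
        W (λ τ → φ (act τ) xor dᶠ ψ′ τ)
          ≡⟨ sum-cong-≗ (λ τ → cong (λ b → bit b * deg τ) (cone-d K K′ b≡ (φ ∘ act) τ)) ⟨
        W (λ τ → sum₂ λ ρ → c′ τ ρ ∧ dᶠ (φ ∘ act) ρ)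
          ≡⟨ sum-cong-≗ (λ τ → ℕ.*-comm (bit (sum₂ λ ρ → c′ τ ρ ∧ dᶠ (φ ∘ act) ρ)) (deg τ)) ⟩
        sum (λ τ → deg τ * bit (sum₂ λ ρ → c′ τ ρ ∧ dᶠ (φ ∘ act) ρ))
          ≤⟨ sum-mono (λ τ → ℕ.*-monoʳ-≤ (deg τ) (bit-sum₂≤ λ ρ → c′ τ ρ ∧ dᶠ (φ ∘ act) ρ)) ⟩
        sum (λ τ → deg τ * sum λ ρ → bit (c′ τ ρ ∧ dᶠ (φ ∘ act) ρ))
          ≡⟨ sum-cong-≗ (λ τ → cong (deg τ *_) (sum-cong-≗ λ ρ → trans (bit-∧ (c′ τ ρ) _)
               (cong (λ b → bit (c′ τ ρ) * bit b) (sym (dᶠ-act φ ρ))))) ⟩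
        sum (λ τ → deg τ * sum λ ρ → bit (c′ τ ρ) * bit (dᶠ φ (act ρ))) ∎
        where
        open ℕ.≤-Reasoning
        open Cone K using (c)
        open Cone K′ using () renaming (c to c′)
        ψ′ ψ : T _ → Bool
        ψ′ σ = sum₂ λ x → c σ x ∧ φ (act x)
        ψ = ψ′ ∘ (P ⟨$⟩ˡ_)

  module _ {ℓ} (G : AutomorphismGroup X ℓ) where
    open AutomorphismGroup G

    -- A table lists the inverse of the map that acts, so composing its entries with the inverse of
    -- `π` lets `π` act first.
    map-*• : ∀ (π : Permutation′ v) f σ → Vec.map (π ⟨$⟩ˡ_) f *• σ ≡ f *• (π • σ)
    map-*• π f σ = Vec.tabulate-cong λ y → trans (cong (lookup σ) (Vec.lookup-map y _ f)) (sym (lookup-• π σ _))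

    IsAut-map : ∀ {π} → Member π → ∀ f → IsAut f → IsAut (Vec.map (π ⟨$⟩ˡ_) f)
    IsAut-map {π} π∈G f (f-inj , f-face) =
      (λ i j eq → f-inj i j (Perm-injective (trans (sym (Vec.lookup-map i _ f)) (trans eq (Vec.lookup-map j _ f))))) ,
      λ σ σ∈X → subst (Face X) (sym (map-*• π f σ)) (f-face _ (Equivalence.to (automorphism π∈G σ) σ∈X))
      where
      Perm-injective : ∀ {i j} → π ⟨$⟩ˡ i ≡ π ⟨$⟩ˡ j → i ≡ j
      Perm-injective eq = trans (sym (Perm.inverseʳ π)) (trans (cong (π ⟨$⟩ʳ_) eq) (Perm.inverseʳ π))

    aut-map : ∀ {π} → Member π → ∀ f → aut (Vec.map (π ⟨$⟩ˡ_) f) ≡ aut f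
    aut-map {π} π∈G f = cong bit (does-⇔ (mk⇔ reflect (IsAut-map π∈G f)) (isAut? (Vec.map (π ⟨$⟩ˡ_) f)) (isAut? f))
      where
      reflect : IsAut (Vec.map (π ⟨$⟩ˡ_) f) → IsAut f
      reflect πf-aut = subst IsAut
        (trans (sym (Vec.map-∘ (π ⟨$⟩ʳ_) (π ⟨$⟩ˡ_) f)) (trans (Vec.map-cong (λ i → Perm.inverseʳ π) f) (Vec.map-id f)))
        (IsAut-map (flip-closed π∈G) (Vec.map (π ⟨$⟩ˡ_) f) πf-aut)

    -- Membership in G is not decidable, so the average runs over all automorphisms of X; G only
    -- contributes its transitivity.
    orbitSum : (Subset v → ℕ) → Subset v → ℕ
    orbitSum B σ = sumᵥ λ f → aut f * B (f *• σ)

    orbitSum-• : ∀ {π} → Member π → ∀ B σ → orbitSum B (π • σ) ≡ orbitSum B σ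
    orbitSum-• {π} π∈G B σ = begin
      sumᵥ (λ f → aut f * B (f *• (π • σ)))
        ≡⟨ sumᵥ-cong (λ f → cong₂ (λ a μ → a * B μ) (sym (aut-map π∈G f)) (sym (map-*• π f σ))) ⟩
      sumᵥ (λ f → aut (Vec.map (π ⟨$⟩ˡ_) f) * B (Vec.map (π ⟨$⟩ˡ_) f *• σ))
        ≡⟨ sumᵥ-permute (λ f → aut f * B (f *• σ)) (Perm.flip π) ⟨
      sumᵥ (λ f → aut f * B (f *• σ)) ∎
      where open ≡-Reasoning

    -- Sum over pairs of a table and an n-face in two ways. By transitivity the orbit sum is the
    -- same at every n-face; conversely each automorphism permutes the n-faces and so contributes
    -- the full sum of `B`.
    orbitSum-average : ∀ n → IsTransitiveOn G n → ∀ B (σ : T (suc n)) →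
      length (faces X (suc n)) * orbitSum B (face X σ) ≡ sumᵥ aut * sum (λ (σ′ : T (suc n)) → B (face X σ′))
    orbitSum-average n trans-G B σ = begin
      length (faces X (suc n)) * orbitSum B (face X σ)
        ≡⟨ sum-const (length (faces X (suc n))) (orbitSum B (face X σ)) ⟨
      sum (λ (σ′ : T (suc n)) → orbitSum B (face X σ))
        ≡⟨ sum-cong-≗ {length (faces X (suc n))} (λ σ′ → const-orbitSum σ′) ⟩
      sum (λ (σ′ : T (suc n)) → orbitSum B (face X σ′))
        ≡⟨ sumᵥ-sum-comm (λ f (σ′ : T (suc n)) → aut f * B (f *• face X σ′)) ⟨
      sumᵥ (λ f → sum λ (σ′ : T (suc n)) → aut f * B (f *• face X σ′))
        ≡⟨ sumᵥ-cong by-f ⟩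
      sumᵥ (λ f → aut f * ∑B)
        ≡⟨ sumᵥ-distribʳ aut ∑B ⟨
      sumᵥ aut * ∑B ∎
      where
      open ≡-Reasoning
      ∑B : ℕ
      ∑B = sum λ (σ′ : T (suc n)) → B (face X σ′)
      const-orbitSum : ∀ σ′ → orbitSum B (face X σ) ≡ orbitSum B (face X σ′)
      const-orbitSum σ′ with trans-G (face X σ) (face X σ′) (face-isFace X σ) (face-isFace X σ′)
      ... | π , π∈G , π•σ≡σ′ = trans (sym (orbitSum-• π∈G B (face X σ))) (cong (orbitSum B) π•σ≡σ′)
      by-f : ∀ f → sum (λ (σ′ : T (suc n)) → aut f * B (f *• face X σ′)) ≡ aut f * ∑B
      by-f f = weighted (isAut? f)
        where
        weighted : (dec : Dec (IsAut f)) →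
          sum (λ (σ′ : T (suc n)) → bit (does dec) * B (f *• face X σ′)) ≡ bit (does dec) * ∑B
        weighted (no _) = trans (sum-const (length (faces X (suc n))) 0) (ℕ.*-zeroʳ (length (faces X (suc n))))
        weighted (yes f-aut) = begin
          sum (λ (σ′ : T (suc n)) → 1 * B (f *• face X σ′))
            ≡⟨ sum-cong-≗ (λ (σ′ : T (suc n)) → trans (ℕ.*-identityˡ (B (f *• face X σ′)))
                 (cong B (trans (*•≡• (face X σ′)) (sym (face-act σ′))))) ⟩
          sum (λ (σ′ : T (suc n)) → B (face X (act σ′)))
            ≡⟨ sum-permute (λ (σ′ : T (suc n)) → B (face X σ′)) P ⟨
          ∑B
            ≡⟨ ℕ.*-identityˡ ∑B ⟨
          1 * ∑B ∎
          where open Action f f-aut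

-- Binomial identities, and inserting or removing a vertex

absorption : ∀ n k → suc k * (suc n C suc k) ≡ suc n * (n C k)
absorption zero    zero    = refl
absorption zero    (suc k) = trans (cong (suc (suc k) *_) (k>n⇒nCk≡0 {1} {suc (suc k)} (s≤s (s≤s z≤n)))) (ℕ.*-zeroʳ k)
absorption (suc n) zero    = trans (cong (1 *_) (nC1≡n (suc (suc n)))) (ℕ.*-comm 1 (suc (suc n)))
absorption (suc n) (suc k) = begin
  suc (suc k) * (suc (suc n) C suc (suc k))
    ≡⟨ cong (suc (suc k) *_) (sym (nCk+nC[k+1]≡[n+1]C[k+1] (suc n) (suc k))) ⟩
  suc (suc k) * (c + (suc n C suc (suc k)))
    ≡⟨ ℕ.*-distribˡ-+ (suc (suc k)) c _ ⟩
  suc (suc k) * c + suc (suc k) * (suc n C suc (suc k))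
    ≡⟨ cong₂ (λ x y → (c + x) + y) (absorption n k) (absorption n (suc k)) ⟩
  (c + suc n * (n C k)) + suc n * (n C suc k)
    ≡⟨ ℕ.+-assoc c _ _ ⟩
  c + (suc n * (n C k) + suc n * (n C suc k))
    ≡⟨ cong (c +_) (sym (ℕ.*-distribˡ-+ (suc n) (n C k) _)) ⟩
  c + suc n * ((n C k) + (n C suc k))
    ≡⟨ cong (λ x → c + suc n * x) (nCk+nC[k+1]≡[n+1]C[k+1] n k) ⟩
  suc (suc n) * c ∎
  where
  open ≡-Reasoning
  c = suc n C suc k

-- After adding `suc k * ((k + t) C k)` to both sides, Pascal's rule reduces this to `absorption`.
-- Writing the upper index as `k + t` avoids a truncated difference.
C-suc : ∀ k t → suc k * ((k + t) C suc k) ≡ t * ((k + t) C k)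
C-suc k t = ℕ.+-cancelˡ-≡ (suc k * ((k + t) C k)) _ _ (begin
  suc k * ((k + t) C k) + suc k * ((k + t) C suc k)   ≡⟨ ℕ.*-distribˡ-+ (suc k) ((k + t) C k) _ ⟨
  suc k * (((k + t) C k) + ((k + t) C suc k))         ≡⟨ cong (suc k *_) (nCk+nC[k+1]≡[n+1]C[k+1] (k + t) k) ⟩
  suc k * (suc (k + t) C suc k)                       ≡⟨ absorption (k + t) k ⟩
  (suc k + t) * ((k + t) C k)                         ≡⟨ ℕ.*-distribʳ-+ ((k + t) C k) (suc k) t ⟩
  suc k * ((k + t) C k) + t * ((k + t) C k)           ∎)
  where open ≡-Reasoning

∣[]≔∣ : ∀ {m} (p : Subset m) x → ∣ p [ x ]≔ inside ∣ ≡ suc ∣ p [ x ]≔ outside ∣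
∣[]≔∣ (_ ∷ p)       zero    = refl
∣[]≔∣ (inside ∷ p)  (suc x) = cong suc (∣[]≔∣ p x)
∣[]≔∣ (outside ∷ p) (suc x) = ∣[]≔∣ p x

module _ {m} {p : Subset m} {x : Fin m} where

  ∈⇒[]≔inside : x ∈ p → p [ x ]≔ inside ≡ p
  ∈⇒[]≔inside x∈p = trans (cong (p [ x ]≔_) (sym (Vec.[]=⇒lookup x∈p))) (Vec.[]≔-lookup p x)

  ∉⇒[]≔outside : x ∉ p → p [ x ]≔ outside ≡ p
  ∉⇒[]≔outside x∉p = trans (cong (p [ x ]≔_) (sym (Bool.¬-not (x∉p ∘ Vec.lookup⇒[]= x p)))) (Vec.[]≔-lookup p x)

  ∈-[]≔ : ∀ {y b} → y ≢ x → y ∈ p → y ∈ p [ x ]≔ b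
  ∈-[]≔ {y} y≢x = Vec.[]≔-minimal p y x y≢x

  ∈-[]≔⁻ : ∀ {y b} → y ≢ x → y ∈ p [ x ]≔ b → y ∈ p
  ∈-[]≔⁻ {y} {b} y≢x y∈ = Vec.lookup⇒[]= y p (trans (sym (Vec.lookup∘update′ y≢x p b)) (Vec.[]=⇒lookup y∈))

  x∉[]≔outside : x ∉ p [ x ]≔ outside
  x∉[]≔outside x∈ = contradiction (trans (sym (Vec.[]=⇒lookup x∈)) (Vec.lookup∘update x p outside)) λ ()

  ∣insert∣ : x ∉ p → ∣ p [ x ]≔ inside ∣ ≡ suc ∣ p ∣
  ∣insert∣ x∉p = trans (∣[]≔∣ p x) (cong (suc ∘ ∣_∣) (∉⇒[]≔outside x∉p))

  ∣remove∣ : x ∈ p → ∣ p ∣ ≡ suc ∣ p [ x ]≔ outside ∣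
  ∣remove∣ x∈p = trans (cong ∣_∣ (sym (∈⇒[]≔inside x∈p))) (∣[]≔∣ p x)

∣∣<⇒∃∉ : ∀ {m} {p q : Subset m} → ∣ p ∣ < ∣ q ∣ → ∃ λ x → x ∈ q × x ∉ p
∣∣<⇒∃∉ {p = p} {q} ∣p∣<∣q∣ with Fin.any? (λ x → (x ∈? q) ×-dec ¬? (x ∈? p))
... | yes w = w
... | no ¬w = contradiction (p⊆q⇒∣p∣≤∣q∣ λ {x} x∈q → decidable-stable (x ∈? p) λ x∉p → ¬w (x , x∈q , x∉p)) (ℕ.<⇒≱ ∣p∣<∣q∣)

bit-∧-mono : ∀ a {b c} → (b ≡ true → c ≡ true) → bit (a ∧ b) ≤ bit (a ∧ c)
bit-∧-mono false         b⇒c = z≤n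
bit-∧-mono true  {false} b⇒c = z≤n
bit-∧-mono true  {true}  b⇒c rewrite b⇒c refl = ℕ.≤-refl

-- The support of a cocycle inside the top faces

module _ {v} (X : SimplicialComplex v) where

  private
    T : ℕ → Set
    T = FaceIndex X

  supportIn : ∀ {s} → (T s → Bool) → Subset v → ℕ
  supportIn α σ = sum λ β → bit (α β ∧ face X β ⊆ᵇ σ)

  hits? : ∀ {s} (α : T s → Bool) σ → Dec (∃ λ β → α β ≡ true × face X β ⊆ σ)
  hits? α σ = Fin.any? λ β → (α β Bool.≟ true) ×-dec (face X β ⊆? σ)

  hits : ∀ {s} → (T s → Bool) → Subset v → ℕ
  hits α σ = bit (does (hits? α σ))

  dᶠ∘dᶠ : ∀ {s} (φ : T s → Bool) μ → dᶠ X (dᶠ X φ) μ ≡ false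
  dᶠ∘dᶠ φ μ = begin
    sum₂ (λ ρ → facet X ρ μ ∧ sum₂ λ τ → facet X τ ρ ∧ φ τ)
      ≡⟨ sum₂-cong (λ ρ → ∧-distribˡ-sum₂ (facet X ρ μ) (λ τ → facet X τ ρ ∧ φ τ)) ⟩
    sum₂ (λ ρ → sum₂ λ τ → facet X ρ μ ∧ facet X τ ρ ∧ φ τ)
      ≡⟨ sum₂-comm (λ ρ τ → facet X ρ μ ∧ facet X τ ρ ∧ φ τ) ⟩
    sum₂ (λ τ → sum₂ λ ρ → facet X ρ μ ∧ facet X τ ρ ∧ φ τ)
      ≡⟨ sum₂-zero vanish ⟩
    false ∎
    where
    open ≡-Reasoning
    vanish : ∀ τ → sum₂ (λ ρ → facet X ρ μ ∧ facet X τ ρ ∧ φ τ) ≡ false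
    vanish τ = begin
      sum₂ (λ ρ → facet X ρ μ ∧ facet X τ ρ ∧ φ τ)
        ≡⟨ sum₂-cong (λ ρ → trans (sym (Bool.∧-assoc (facet X ρ μ) (facet X τ ρ) (φ τ)))
             (cong (_∧ φ τ) (Bool.∧-comm (facet X ρ μ) (facet X τ ρ)))) ⟩
      sum₂ (λ ρ → (facet X τ ρ ∧ facet X ρ μ) ∧ φ τ)
        ≡⟨ ∧-distribʳ-sum₂ (φ τ) (λ ρ → facet X τ ρ ∧ facet X ρ μ) ⟨
      sum₂ (λ ρ → facet X τ ρ ∧ facet X ρ μ) ∧ φ τ
        ≡⟨ cong (_∧ φ τ) (facet∘facet X τ μ) ⟩
      false ∎

  module _ {s} (α : T s → Bool) (dα≡0 : ∀ μ → dᶠ X α μ ≡ false) where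

    -- Every vertex x of τ outside β₀ is witnessed by a member of the support: another facet of β₀ ∪ {x}.
    cocycle-support : ∀ {β₀} → α β₀ ≡ true → ∀ m {τ} → Face X τ → ∣ τ ∣ ≡ m + s → face X β₀ ⊆ τ →
      suc m ≤ supportIn α τ
    cocycle-support {β₀} αβ₀ zero {τ} τ∈X ∣τ∣ β₀⊆τ = ℕ.≤-trans
      (ℕ.≤-reflexive (sym (cong₂ (λ a b → bit (a ∧ b)) αβ₀ (⊆ᵇ-true β₀⊆τ))))
      (term≤sum (λ β → bit (α β ∧ face X β ⊆ᵇ τ)) β₀)
    cocycle-support {β₀} αβ₀ (suc m) {τ} τ∈X ∣τ∣ β₀⊆τ
      with ∣∣<⇒∃∉ {p = face X β₀} {τ} (subst₂ _<_ (sym (∣face∣ X β₀)) (sym ∣τ∣) (s≤s (ℕ.m≤n+m s m)))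
    ... | x , x∈τ , x∉β₀ = ℕ.≤-trans
      (s≤s (cocycle-support αβ₀ m (downward X τ′⊆τ τ∈X) (ℕ.suc-injective (trans (sym (∣remove∣ x∈τ)) ∣τ∣)) β₀⊆τ′))
      (sum-mono-< (λ β → bit-∧-mono (α β) λ β⊆τ′ → ⊆ᵇ-true (λ y∈β → τ′⊆τ (⊆ᵇ-⊆ {p = face X β} β⊆τ′ y∈β))) β₁ strict)
      where
      τ′ = τ [ x ]≔ outside
      μ = face X β₀ [ x ]≔ inside

      τ′⊆τ : τ′ ⊆ τ
      τ′⊆τ {y} y∈τ′ with y Fin.≟ x
      ... | yes refl = x∈τ
      ... | no y≢x = ∈-[]≔⁻ y≢x y∈τ′

      β₀⊆τ′ : face X β₀ ⊆ τ′
      β₀⊆τ′ {y} y∈β₀ = ∈-[]≔ (λ { refl → x∉β₀ y∈β₀ }) (β₀⊆τ y∈β₀)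

      μ⊆τ : μ ⊆ τ
      μ⊆τ {y} y∈μ with y Fin.≟ x
      ... | yes refl = x∈τ
      ... | no y≢x = β₀⊆τ (∈-[]≔⁻ y≢x y∈μ)

      β₀⊆μ : face X β₀ ⊆ μ
      β₀⊆μ {y} y∈β₀ = ∈-[]≔ (λ { refl → x∉β₀ y∈β₀ }) y∈β₀

      μ-isFace : IsFace X (suc s) μ
      μ-isFace = downward X μ⊆τ τ∈X , trans (∣insert∣ x∉β₀) (cong suc (∣face∣ X β₀))

      another : ∃ λ β → β ≢ β₀ × facet X β (faceIndex X μ-isFace) ∧ α β ≡ true
      another = sum₂-false⇒another _ β₀ (dα≡0 (faceIndex X μ-isFace))
        (cong₂ _∧_ (⊆ᵇ-true (subst (face X β₀ ⊆_) (sym (face-faceIndex X μ-isFace)) β₀⊆μ)) αβ₀)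

      β₁ : T s
      β₁ = proj₁ another

      β₁⊆μ : face X β₁ ⊆ μ
      β₁⊆μ = subst (face X β₁ ⊆_) (face-faceIndex X μ-isFace) (⊆ᵇ-⊆ (Bool.∧-conicalˡ _ _ (proj₂ (proj₂ another))))

      αβ₁ : α β₁ ≡ true
      αβ₁ = Bool.∧-conicalʳ (facet X β₁ (faceIndex X μ-isFace)) _ (proj₂ (proj₂ another))

      -- A facet of `μ` avoiding `x` would lie in `β₀` and equal it by size, but `β₁` was chosen
      -- different from `β₀`.
      x∈β₁ : x ∈ face X β₁
      x∈β₁ = decidable-stable (x ∈? face X β₁) λ x∉β₁ → proj₁ (proj₂ another)
        (face-injective X (⊆-size⇒≡ (λ {y} y∈β₁ → ∈-[]≔⁻ (λ { refl → x∉β₁ y∈β₁ }) (β₁⊆μ y∈β₁))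
          (trans (∣face∣ X β₁) (sym (∣face∣ X β₀)))))

      strict : bit (α β₁ ∧ face X β₁ ⊆ᵇ τ′) < bit (α β₁ ∧ face X β₁ ⊆ᵇ τ)
      strict = subst₂ _<_
        (sym (cong₂ (λ a b → bit (a ∧ b)) αβ₁ (dec-false (face X β₁ ⊆? τ′) λ β₁⊆τ′ → x∉[]≔outside (β₁⊆τ′ x∈β₁))))
        (sym (cong₂ (λ a b → bit (a ∧ b)) αβ₁ (⊆ᵇ-true {p = face X β₁} λ y∈β₁ → μ⊆τ (β₁⊆μ y∈β₁))))
        (s≤s z≤n)

    -- Double counting of pairs of a support member and an n-face containing it. For a (k+1)-cochain
    -- `s` is k + 2, so `suc m` is n - k.
    hits≤W : ∀ m n → suc n ≡ m + s → suc m * sum (λ (σ : T (suc n)) → hits α (face X σ)) ≤ W X n α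
    hits≤W m n eq = begin
      suc m * sum (λ (σ : T (suc n)) → hits α (face X σ))
        ≡⟨ *-distribˡ-sum (suc m) (λ (σ : T (suc n)) → hits α (face X σ)) ⟩
      sum (λ (σ : T (suc n)) → suc m * hits α (face X σ))
        ≤⟨ sum-mono {length (faces X (suc n))} pointwise ⟩
      sum (λ (σ : T (suc n)) → supportIn α (face X σ))
        ≡⟨ ∑-comm (λ (σ : T (suc n)) β → bit (α β ∧ face X β ⊆ᵇ face X σ)) ⟩
      sum (λ β → sum λ (σ : T (suc n)) → bit (α β ∧ face X β ⊆ᵇ face X σ))
        ≡⟨ sum-cong-≗ (λ β → trans (sum-cong-≗ λ (σ : T (suc n)) → bit-∧ (α β) (face X β ⊆ᵇ face X σ))
             (sym (*-distribˡ-sum (bit (α β)) (λ (σ : T (suc n)) → bit (face X β ⊆ᵇ face X σ))))) ⟩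
      sum (λ β → bit (α β) * sum λ (σ : T (suc n)) → bit (face X β ⊆ᵇ face X σ)) ∎
      where
      open ℕ.≤-Reasoning
      pointwise : ∀ (σ : T (suc n)) → suc m * hits α (face X σ) ≤ supportIn α (face X σ)
      pointwise σ with hits? α (face X σ)
      ... | no _ = ℕ.≤-trans (ℕ.≤-reflexive (ℕ.*-zeroʳ (suc m))) z≤n
      ... | yes (β , αβ , β⊆σ) = ℕ.≤-trans (ℕ.≤-reflexive (ℕ.*-identityʳ (suc m)))
        (cocycle-support αβ m (Face-face X σ) (trans (∣face∣ X σ) eq) β⊆σ)

  -- With denominators cleared, this says that the weights in each dimension have total 1.
  sum-deg : ∀ n s → sum (λ (τ : T s) → deg X n τ) ≡ length (faces X (suc n)) * (suc n C s)
  sum-deg n s = begin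
    sum (λ (τ : T s) → sum λ (σ : T (suc n)) → bit (face X τ ⊆ᵇ face X σ))
      ≡⟨ ∑-comm (λ (τ : T s) (σ : T (suc n)) → bit (face X τ ⊆ᵇ face X σ)) ⟩
    sum (λ (σ : T (suc n)) → sum λ (τ : T s) → bit (face X τ ⊆ᵇ face X σ))
      ≡⟨ sum-cong-≗ (λ (σ : T (suc n)) → subface-count X s (Face-face X σ) (∣face∣ X σ)) ⟩
    sum (λ (σ : T (suc n)) → suc n C s)
      ≡⟨ sum-const (length (faces X (suc n))) (suc n C s) ⟩
    length (faces X (suc n)) * (suc n C s) ∎
    where open ≡-Reasoning

  id-isAut : IsAut X (Vec.allFin v)
  id-isAut = (λ i j eq → trans (sym (Vec.lookup-allFin i)) (trans eq (Vec.lookup-allFin j))) ,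
    λ σ σ∈X → subst (Face X) (sym (trans (Vec.tabulate-cong λ y → cong (lookup σ) (Vec.lookup-allFin y)) (Vec.tabulate∘lookup σ))) σ∈X

  0<∑aut : 0 < sumᵥ (aut X)
  0<∑aut = ℕ.<-≤-trans (ℕ.≤-reflexive (sym (cong bit (dec-true (isAut? X (Vec.allFin v)) id-isAut)))) (term≤sumᵥ (aut X) (Vec.allFin v))

-- Natural numbers inside the rationals, and bounding a quotient

0<C : ∀ {n k} → k ≤ n → 0 < n C k
0<C {n}     {zero}  _         = s≤s z≤n
0<C {suc n} {suc k} (s≤s k≤n) = ℕ.<-≤-trans (0<C k≤n)
  (ℕ.≤-trans (ℕ.m≤m+n (n C k) _) (ℕ.≤-reflexive (nCk+nC[k+1]≡[n+1]C[k+1] n k)))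

fromℕ-mkℚ : ∀ m → fromℕ m ≡ mkℚ (ℤ.+ m) 0 (Coprimality.sym (Coprimality.1-coprimeTo m))
fromℕ-mkℚ m = ℚ.normalize-coprime (Coprimality.sym (Coprimality.1-coprimeTo m))

fromℕ-+ : ∀ a b → fromℕ (a + b) ≡ fromℕ a ℚ.+ fromℕ b
fromℕ-+ a b = sym (trans (cong₂ ℚ._+_ (fromℕ-mkℚ a) (fromℕ-mkℚ b))
  (cong (λ i → i ℚ./ 1) (cong₂ ℤ._+_ (ℤ.*-identityʳ (ℤ.+ a)) (ℤ.*-identityʳ (ℤ.+ b)))))

fromℕ-* : ∀ a b → fromℕ (a * b) ≡ fromℕ a ℚ.* fromℕ b
fromℕ-* a b = sym (trans (cong₂ ℚ._*_ (fromℕ-mkℚ a) (fromℕ-mkℚ b)) (cong (λ i → i ℚ./ 1) (sym (ℤ.pos-* a b))))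

fromℕ-mono-≤ : ∀ {a b} → a ≤ b → fromℕ a ℚ.≤ fromℕ b
fromℕ-mono-≤ {a} {b} a≤b = subst₂ ℚ._≤_ (sym (fromℕ-mkℚ a)) (sym (fromℕ-mkℚ b))
  (ℚ.*≤* (ℤ.*-monoʳ-≤-nonNeg (ℤ.+ 1) (ℤ.+≤+ a≤b)))

fromℕ-cancel-≤ : ∀ {a b} → fromℕ a ℚ.≤ fromℕ b → a ≤ b
fromℕ-cancel-≤ {a} {b} a≤b with subst₂ ℚ._≤_ (fromℕ-mkℚ a) (fromℕ-mkℚ b) a≤b
... | ℚ.*≤* a≤b′ = ℤ.drop‿+≤+ (ℤ.*-cancelʳ-≤-pos (ℤ.+ a) (ℤ.+ b) (ℤ.+ 1) a≤b′)

fromℕ-positive : ∀ m → .{{_ : ℕ.NonZero m}} → ℚ.Positive (fromℕ m)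
fromℕ-positive m = ℚ.normalize-pos m 1

fromℕ-≢0 : ∀ {m} → 0 < m → fromℕ m ≢ 0ℚ
fromℕ-≢0 {m} 0<m eq = ℕ.<⇒≱ 0<m (fromℕ-cancel-≤ {m} {0} (ℚ.≤-reflexive eq))

sum-fromℕ : ∀ {n} (f : Fin n → ℕ) → sumℚ (fromℕ ∘ f) ≡ fromℕ (sum f)
sum-fromℕ {zero}  f = refl
sum-fromℕ {suc n} f = trans (cong (fromℕ (f zero) ℚ.+_) (sum-fromℕ (f ∘ suc))) (sym (fromℕ-+ (f zero) _))

÷₀-* : ∀ p q → q ≢ 0ℚ → (p ÷₀ q) ℚ.* q ≡ p
÷₀-* p q q≢0 with q ℚ.≟ 0ℚ
... | yes q≡0 = contradiction q≡0 q≢0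
... | no  q≢0′ = trans (ℚ.*-assoc p _ q) (trans (cong (p ℚ.*_) (ℚ.*-inverseˡ q {{ℚ.≢-nonZero q≢0′}})) (ℚ.*-identityʳ p))

1/suc* : ∀ c → (ℤ.+ 1 ℚ./ suc c) ℚ.* fromℕ (suc c) ≡ 1ℚ
1/suc* c = trans (cong₂ ℚ._*_ (ℚ.normalize-coprime (Coprimality.1-coprimeTo (suc c))) (fromℕ-mkℚ (suc c)))
  (ℚ.*-inverseˡ (mkℚ (ℤ.+ suc c) 0 (Coprimality.sym (Coprimality.1-coprimeTo (suc c)))))

-- Here x = W₁ / b and y = W₀ / a; both sides are multiplied by (c + 1) y a b.
1/suc≤÷₀ : ∀ c x y a b W₀ W₁ → 0 < a → 0 < b → 0 < W₀ →
  y ℚ.* fromℕ a ≡ fromℕ W₀ → x ℚ.* fromℕ b ≡ fromℕ W₁ →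
  W₀ * b ≤ suc c * (W₁ * a) → (ℤ.+ 1 ℚ./ suc c) ℚ.≤ x ÷₀ y
1/suc≤÷₀ c x y a b W₀ W₁ 0<a 0<b 0<W₀ ya≡ xb≡ W₀b≤ =
  ℚ.*-cancelʳ-≤-pos (fromℕ R) {{fromℕ-positive R {{ℕ.>-nonZero 0<R}}}} (subst₂ ℚ._≤_ (sym lhs) (sym rhs) (fromℕ-mono-≤ W₀b≤))
  where
  open ≡-Reasoning
  R = suc c * (W₀ * b)
  u = ℤ.+ 1 ℚ./ suc c
  r = x ÷₀ y
  s = fromℕ (suc c)
  0<R : 0 < R
  0<R = ℕ.*-mono-< {0} {suc c} {0} {W₀ * b} (s≤s z≤n) (ℕ.*-mono-< {0} {W₀} {0} {b} 0<W₀ 0<b)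
  y≢0 : y ≢ 0ℚ
  y≢0 refl = fromℕ-≢0 0<W₀ (trans (sym ya≡) (ℚ.*-zeroˡ (fromℕ a)))
  lhs : u ℚ.* fromℕ R ≡ fromℕ (W₀ * b)
  lhs = begin
    u ℚ.* fromℕ R                      ≡⟨ cong (u ℚ.*_) (fromℕ-* (suc c) (W₀ * b)) ⟩
    u ℚ.* (s ℚ.* fromℕ (W₀ * b))       ≡⟨ ℚ.*-assoc u s _ ⟨
    u ℚ.* s ℚ.* fromℕ (W₀ * b)         ≡⟨ cong (ℚ._* fromℕ (W₀ * b)) (1/suc* c) ⟩
    1ℚ ℚ.* fromℕ (W₀ * b)              ≡⟨ ℚ.*-identityˡ _ ⟩
    fromℕ (W₀ * b)                     ∎
  rhs : r ℚ.* fromℕ R ≡ fromℕ (suc c * (W₁ * a))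
  rhs = begin
    r ℚ.* fromℕ R                              ≡⟨ cong (r ℚ.*_) (fromℕ-* (suc c) (W₀ * b)) ⟩
    r ℚ.* (s ℚ.* fromℕ (W₀ * b))
      ≡⟨ trans (sym (ℚ.*-assoc r s _)) (trans (cong (ℚ._* fromℕ (W₀ * b)) (ℚ.*-comm r s)) (ℚ.*-assoc s r _)) ⟩
    s ℚ.* (r ℚ.* fromℕ (W₀ * b))
      ≡⟨ cong (λ z → s ℚ.* (r ℚ.* z)) (trans (fromℕ-* W₀ b) (cong (ℚ._* fromℕ b) (sym ya≡))) ⟩
    s ℚ.* (r ℚ.* (y ℚ.* fromℕ a ℚ.* fromℕ b))
      ≡⟨ cong (λ z → s ℚ.* (r ℚ.* z)) (trans (ℚ.*-assoc y _ _) (cong (y ℚ.*_) (ℚ.*-comm (fromℕ a) (fromℕ b)))) ⟩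
    s ℚ.* (r ℚ.* (y ℚ.* (fromℕ b ℚ.* fromℕ a)))  ≡⟨ cong (s ℚ.*_) (sym (ℚ.*-assoc r y _)) ⟩
    s ℚ.* (r ℚ.* y ℚ.* (fromℕ b ℚ.* fromℕ a))  ≡⟨ cong (λ z → s ℚ.* (z ℚ.* (fromℕ b ℚ.* fromℕ a))) (÷₀-* x y y≢0) ⟩
    s ℚ.* (x ℚ.* (fromℕ b ℚ.* fromℕ a))        ≡⟨ cong (s ℚ.*_) (sym (ℚ.*-assoc x _ _)) ⟩
    s ℚ.* (x ℚ.* fromℕ b ℚ.* fromℕ a)          ≡⟨ cong (λ z → s ℚ.* (z ℚ.* fromℕ a)) xb≡ ⟩
    s ℚ.* (fromℕ W₁ ℚ.* fromℕ a)               ≡⟨ cong (s ℚ.*_) (sym (fromℕ-* W₁ a)) ⟩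
    s ℚ.* fromℕ (W₁ * a)                       ≡⟨ fromℕ-* (suc c) (W₁ * a) ⟨
    fromℕ (suc c * (W₁ * a))                   ∎

1/∞≤ : ∀ m {x} → 0 < m → (∀ c → m ≡ suc c → (ℤ.+ 1 ℚ./ suc c) ℚ.≤ x) → 1/∞ [ m ] ≤ℚ∞ [ x ]
1/∞≤ (suc c) 0<m 1/m≤x = ℚ≤.[ 1/m≤x c refl ]

lookup-extensionality : ∀ {a} {A : Set a} {m} {xs ys : Vec A m} → (∀ i → lookup xs i ≡ lookup ys i) → xs ≡ ys
lookup-extensionality {xs = xs} {ys} eq = trans (sym (Vec.tabulate∘lookup xs)) (trans (Vec.tabulate-cong eq) (Vec.tabulate∘lookup ys))

xor≡false⇒≡ : ∀ a b → a xor b ≡ false → a ≡ b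
xor≡false⇒≡ false false eq = refl
xor≡false⇒≡ true  true  eq = refl

-- The averaged distance bound and the expansion constant

module _ {v} (X : SimplicialComplex v) (n : ℕ) where

  private
    T : ℕ → Set
    T = FaceIndex X
    N = length (faces X (suc n))

  module _ (pure : IsPure X n) where

    container : ∀ {s} (τ : T s) → ∃ λ (σ : T (suc n)) → face X τ ⊆ face X σ
    container τ with pure (face X τ) (Face-face X τ)
    ... | σ , σ-isFace , τ⊆σ = faceIndex X σ-isFace , subst (face X τ ⊆_) (sym (face-faceIndex X σ-isFace)) τ⊆σ

    facet₀ : T (suc n)
    facet₀ = proj₁ (container (faceIndex X (empty X , ∣⊥∣≡0 v)))

    0<N : 0 < N
    0<N = ℕ.≤-<-trans z≤n (Fin.toℕ<n facet₀)

    0<deg : ∀ {s} (τ : T s) → 0 < deg X n τ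
    0<deg τ with container τ
    ... | σ , τ⊆σ = ℕ.<-≤-trans (ℕ.≤-reflexive (sym (cong bit (⊆ᵇ-true τ⊆σ))))
      (term≤sum (λ σ → bit (face X τ ⊆ᵇ face X σ)) σ)

    apex : T 1
    apex with ∣∣<⇒∃∉ {p = ⊥} {face X facet₀} (subst₂ _<_ (sym (∣⊥∣≡0 v)) (sym (∣face∣ X facet₀)) (s≤s z≤n))
    ... | x , _ , _ = faceIndex X (vertex X x , ∣⁅x⁆∣≡1 x)

    -- Add up the bounds on `D` over all `A` automorphisms. For each `ρ` in the cone of `τ` the
    -- average over translates turns `N` times the hits of its n-face into `A * H`; there are at
    -- most `m′` such `ρ`, and the degrees sum to `N` times the binomial coefficient. Finally the
    -- positive factor `N * A` cancels.
    coboundary-distance-≤ : ∀ {ℓ} (G : AutomorphismGroup X ℓ) → IsTransitiveOn G n →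
      ∀ {s m m′} (K : Cone X s m) (K′ : Cone X (suc s) m′) →
      (∀ μ x → Cone.b K′ μ x ≡ coneBase X K μ x) →
      ∀ φ D → (∀ ψ → D ≤ W X n (λ τ → φ τ xor dᶠ X ψ τ)) →
      D ≤ (suc n C suc s) * (m′ * sum λ (σ : T (suc n)) → hits X (dᶠ X φ) (face X σ))
    coboundary-distance-≤ G trans-G {s} {m} {m′} K K′ b≡ φ D D≤ =
      ℕ.*-cancelˡ-≤ (N * A) {{ℕ.>-nonZero (ℕ.*-mono-< {0} {N} {0} {A} 0<N (0<∑aut X))}} (begin
        N * A * D
          ≡⟨ ℕ.*-assoc N A D ⟩
        N * (A * D)
          ≡⟨ cong (N *_) (sumᵥ-distribʳ (aut X) D) ⟩
        N * sumᵥ (λ f → aut X f * D)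
          ≤⟨ ℕ.*-monoʳ-≤ N (sumᵥ-mono λ f → weighted f (isAut? X f)) ⟩
        N * sumᵥ (λ f → sum λ τ → deg X n τ * sum λ ρ → bit (c τ ρ) * (aut X f * B (f *• face X (above ρ))))
          ≡⟨ cong (N *_) (sumᵥ-sum-comm λ f τ → deg X n τ * sum λ ρ → bit (c τ ρ) * (aut X f * B (f *• face X (above ρ)))) ⟩
        N * sum (λ τ → sumᵥ λ f → deg X n τ * sum λ ρ → bit (c τ ρ) * (aut X f * B (f *• face X (above ρ))))
          ≡⟨ *-distribˡ-sum N (λ τ → sumᵥ λ f → deg X n τ * sum λ ρ → bit (c τ ρ) * (aut X f * B (f *• face X (above ρ)))) ⟩
        sum (λ τ → N * sumᵥ λ f → deg X n τ * sum λ ρ → bit (c τ ρ) * (aut X f * B (f *• face X (above ρ))))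
          ≤⟨ sum-mono per-face ⟩
        sum (λ τ → deg X n τ * (m′ * (A * H)))
          ≡⟨ *-distribʳ-sum (m′ * (A * H)) (λ (τ : T (suc s)) → deg X n τ) ⟨
        sum (λ (τ : T (suc s)) → deg X n τ) * (m′ * (A * H))
          ≡⟨ cong (_* (m′ * (A * H))) (sum-deg X n (suc s)) ⟩
        N * (suc n C suc s) * (m′ * (A * H))
          ≡⟨ solve 5 (λ N C m A H → N :* C :* (m :* (A :* H)) := N :* A :* (C :* (m :* H))) refl N (suc n C suc s) m′ A H ⟩
        N * A * ((suc n C suc s) * (m′ * H)) ∎)
      where
      open ℕ.≤-Reasoning
      open +-*-Solver
      open Cone K′ using (c; small)
      A = sumᵥ (aut X)
      B : Subset v → ℕ
      B = hits X (dᶠ X φ)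
      H = sum λ (σ : T (suc n)) → B (face X σ)
      above : T (suc (suc s)) → T (suc n)
      above ρ = proj₁ (container ρ)

      weighted : ∀ f (dec : Dec (IsAut X f)) → bit (does dec) * D ≤
        sum λ τ → deg X n τ * sum λ ρ → bit (c τ ρ) * (bit (does dec) * B (f *• face X (above ρ)))
      weighted f (no _) = z≤n
      weighted f (yes f-aut) = ℕ.≤-trans (ℕ.≤-reflexive (ℕ.*-identityˡ D)) (ℕ.≤-trans
        (coboundary-distance-act X n f f-aut K K′ b≡ φ D D≤)
        (sum-mono λ τ → ℕ.*-monoʳ-≤ (deg X n τ) (sum-mono λ ρ → ℕ.*-monoʳ-≤ (bit (c τ ρ))
          (ℕ.≤-trans (hit ρ) (ℕ.≤-reflexive (sym (ℕ.*-identityˡ _)))))))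
        where
        open Action X f f-aut
        -- The event is enlarged here from `ρ` to the n-face above it, the only kind of face on
        -- which the action is known to be transitive.
        hit : ∀ ρ → bit (dᶠ X φ (act ρ)) ≤ B (f *• face X (above ρ))
        hit ρ with dᶠ X φ (act ρ) in eq
        ... | false = z≤n
        ... | true  = ℕ.≤-reflexive (sym (cong bit (dec-true (hits? X (dᶠ X φ) (f *• face X (above ρ)))
          (act ρ , eq , subst₂ _⊆_ (sym (face-act ρ)) (sym (*•≡• (face X (above ρ)))) (•-mono π (proj₂ (container ρ)))))))

      per-face : ∀ τ → N * sumᵥ (λ f → deg X n τ * sum λ ρ → bit (c τ ρ) * (aut X f * B (f *• face X (above ρ))))
        ≤ deg X n τ * (m′ * (A * H))
      per-face τ = begin
        N * sumᵥ (λ f → deg X n τ * sum λ ρ → bit (c τ ρ) * (aut X f * B (f *• face X (above ρ))))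
          ≡⟨ cong (N *_) (trans (sumᵥ-cong λ f → ℕ.*-comm (deg X n τ) (sum λ ρ → bit (c τ ρ) * (aut X f * B (f *• face X (above ρ)))))
               (sym (sumᵥ-distribʳ (λ f → sum λ ρ → bit (c τ ρ) * (aut X f * B (f *• face X (above ρ)))) (deg X n τ)))) ⟩
        N * (sumᵥ (λ f → sum λ ρ → bit (c τ ρ) * (aut X f * B (f *• face X (above ρ)))) * deg X n τ)
          ≡⟨ cong (λ z → N * (z * deg X n τ)) (trans (sumᵥ-sum-comm λ f ρ → bit (c τ ρ) * (aut X f * B (f *• face X (above ρ))))
               (sum-cong-≗ λ ρ → trans (sumᵥ-cong λ f → ℕ.*-comm (bit (c τ ρ)) (aut X f * B (f *• face X (above ρ))))
                 (sym (sumᵥ-distribʳ (λ f → aut X f * B (f *• face X (above ρ))) (bit (c τ ρ)))))) ⟩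
        N * (sum (λ ρ → orbitSum X G B (face X (above ρ)) * bit (c τ ρ)) * deg X n τ)
          ≡⟨ sym (ℕ.*-assoc N _ (deg X n τ)) ⟩
        N * sum (λ ρ → orbitSum X G B (face X (above ρ)) * bit (c τ ρ)) * deg X n τ
          ≡⟨ cong (_* deg X n τ) (trans (*-distribˡ-sum N (λ ρ → orbitSum X G B (face X (above ρ)) * bit (c τ ρ)))
               (sum-cong-≗ λ ρ → trans (sym (ℕ.*-assoc N (orbitSum X G B (face X (above ρ))) (bit (c τ ρ))))
                 (trans (cong (_* bit (c τ ρ)) (orbitSum-average X G n trans-G B (above ρ))) (ℕ.*-comm (A * H) (bit (c τ ρ)))))) ⟩
        sum (λ ρ → bit (c τ ρ) * (A * H)) * deg X n τ
          ≡⟨ cong (_* deg X n τ) (*-distribʳ-sum (A * H) (bit ∘ c τ)) ⟨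
        sum (bit ∘ c τ) * (A * H) * deg X n τ
          ≡⟨ ℕ.*-comm _ (deg X n τ) ⟩
        deg X n τ * (sum (bit ∘ c τ) * (A * H))
          ≤⟨ ℕ.*-monoʳ-≤ (deg X n τ) (ℕ.*-monoˡ-≤ (A * H) (small τ)) ⟩
        deg X n τ * (m′ * (A * H)) ∎

    expansion : ∀ {ℓ} (G : AutomorphismGroup X ℓ) → IsTransitiveOn G n →
      ∀ {k m m′} → k < n → (K : Cone X k m) (K′ : Cone X (suc k) m′) →
      (∀ μ x → Cone.b K′ μ x ≡ coneBase X K μ x) →
      ∀ φ D → (∀ ψ → D ≤ W X n (λ τ → φ τ xor dᶠ X ψ τ)) →
      D * (suc n C suc (suc k)) ≤ (suc n C suc k) * m′ * (W X n (dᶠ X φ) * (suc n C suc k))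
    expansion G trans-G {k} {m} {m′} k<n K K′ b≡ φ D D≤ = begin
      D * C₁
        -- A factor k + 2 is given away, which brings the left side into the form (k + 2) C(n+1,
        -- k+2) = (n - k) C(n+1, k+1).
        ≤⟨ ℕ.*-monoʳ-≤ D (ℕ.m≤n*m C₁ (suc (suc k))) ⟩
      D * (suc (suc k) * C₁)
        ≡⟨ cong (D *_) (subst (λ z → suc (suc k) * (z C suc (suc k)) ≡ suc t * (z C suc k)) n≡ (C-suc (suc k) (suc t))) ⟩
      D * (suc t * C₀)
        ≤⟨ ℕ.*-monoˡ-≤ (suc t * C₀) (coboundary-distance-≤ G trans-G K K′ b≡ φ D D≤) ⟩
      C₀ * (m′ * H) * (suc t * C₀)
        ≡⟨ solve 4 (λ C m H t → C :* (m :* H) :* (t :* C) := C :* m :* (t :* H :* C)) refl C₀ m′ H (suc t) ⟩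
      C₀ * m′ * (suc t * H * C₀)
        ≤⟨ ℕ.*-monoʳ-≤ (C₀ * m′) (ℕ.*-monoˡ-≤ C₀ (hits≤W X (dᶠ X φ) (dᶠ∘dᶠ X φ) t n
             (trans (sym n≡) (trans (ℕ.+-comm (suc k) (suc t)) (sym (ℕ.+-suc t (suc k))))))) ⟩
      C₀ * m′ * (W X n (dᶠ X φ) * C₀) ∎
      where
      open ℕ.≤-Reasoning
      open +-*-Solver
      -- Thus `suc t` is n - k, a true difference because `k < n`.
      t  = n ∸ suc k
      C₀ = suc n C suc k
      C₁ = suc n C suc (suc k)
      H  = sum λ (σ : T (suc n)) → hits X (dᶠ X φ) (face X σ)
      n≡ : suc k + suc t ≡ suc n
      n≡ = trans (ℕ.+-suc (suc k) t) (cong suc (ℕ.m+[n∸m]≡n k<n))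

    -- The common denominator of all weights of faces with `s` vertices; multiplication by it turns
    -- `w` into `W`.
    mass : ℕ → ℕ
    mass s = (suc n C s) * N

    0<mass : ∀ {s} → s ≤ suc n → 0 < mass s
    0<mass {s} s≤ = ℕ.*-mono-< {0} {suc n C s} {0} {N} (0<C s≤) 0<N

    weight-mass : ∀ {s} → s ≤ suc n → (τ : T s) → weight X n τ ℚ.* fromℕ (mass s) ≡ fromℕ (deg X n τ)
    weight-mass {s} s≤ τ = trans
      (÷₀-* (fromℕ (length (filter (face X τ ⊆?_) (faces X (suc n))))) (fromℕ (mass s)) (fromℕ-≢0 (0<mass s≤)))
      (cong fromℕ (length-filter≡sum (face X τ ⊆?_) (faces X (suc n))))

    w-mass : ∀ {s} → s ≤ suc n → (φ : Cochain X s) → w X n φ ℚ.* fromℕ (mass s) ≡ fromℕ (W X n (lookup φ))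
    w-mass {s} s≤ φ = trans (*-distribʳ-sumℚ (fromℕ (mass s)) (λ τ → if lookup φ τ then weight X n τ else 0ℚ))
      (trans (sumℚ-cong λ τ → term (lookup φ τ) τ) (sum-fromℕ (λ τ → bit (lookup φ τ) * deg X n τ)))
      where
      term : ∀ b (τ : T s) → (if b then weight X n τ else 0ℚ) ℚ.* fromℕ (mass s) ≡ fromℕ (bit b * deg X n τ)
      term false τ = ℚ.*-zeroˡ (fromℕ (mass s))
      term true  τ = trans (weight-mass s≤ τ) (cong fromℕ (sym (ℕ.*-identityˡ (deg X n τ))))

    W-mono-w : ∀ {s} → s ≤ suc n → (φ ψ : Cochain X s) → w X n φ ℚ.≤ w X n ψ → W X n (lookup φ) ≤ W X n (lookup ψ)
    W-mono-w {s} s≤ φ ψ wφ≤wψ = fromℕ-cancel-≤ (subst₂ ℚ._≤_ (w-mass s≤ φ) (w-mass s≤ ψ)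
      (ℚ.*-monoʳ-≤-nonNeg (fromℕ (mass s)) {{ℚ.normalize-nonNeg (mass s) 1}} wφ≤wψ))

    -- By purity every face has positive degree, so a single face in the support already makes `W`
    -- positive.
    W≡0⇒≡false : ∀ {s} (φ : T s → Bool) → ¬ (0 < W X n φ) → ∀ τ → φ τ ≡ false
    W≡0⇒≡false φ W≡0 τ = Bool.¬-not λ φτ → W≡0 (ℕ.<-≤-trans
      (subst (λ b → 0 < bit b * deg X n τ) (sym φτ) (ℕ.<-≤-trans (0<deg τ) (ℕ.≤-reflexive (sym (ℕ.*-identityˡ _)))))
      (term≤sum (λ τ → bit (φ τ) * deg X n τ) τ))

  _+ᶜ_ : ∀ {s} → Cochain X s → Cochain X s → Cochain X s
  _+ᶜ_ = Vec.zipWith _xor_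

  lookup-d : ∀ {s} (φ : Cochain X s) σ → lookup (d X φ) σ ≡ dᶠ X (lookup φ) σ
  lookup-d φ σ = Vec.lookup∘tabulate (λ σ → sum₂ λ τ → facet X τ σ ∧ lookup φ τ) σ

  0-isCoboundary : ∀ k → IsCoboundary X k ⊥
  0-isCoboundary k = ⊥ , lookup-extensionality λ σ → trans (lookup-d ⊥ σ) (trans
    (sum₂-zero λ τ → trans (cong (facet X τ σ ∧_) (Vec.lookup-replicate τ false)) (Bool.∧-zeroʳ (facet X τ σ)))
    (sym (Vec.lookup-replicate σ false)))

  distance-attained : ∀ k φ → ∃ λ ψ → IsCoboundary X k ψ × distance X n k φ ≡ w X n (φ +ᶜ ψ)
  distance-attained k φ =
    [ (λ distance≡wφ → ⊥ , 0-isCoboundary k , trans distance≡wφ (cong (w X n) (sym φ+0≡φ))) , id ]′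
    (min-sel ℚ-totalOrder (λ ψ → w X n (φ +ᶜ ψ)) (isCoboundary? X k) (w X n φ) (allCochains X (suc k)))
    where
    φ+0≡φ : φ +ᶜ ⊥ ≡ φ
    φ+0≡φ = lookup-extensionality λ τ → trans (Vec.lookup-zipWith _xor_ τ φ ⊥)
      (trans (cong (lookup φ τ xor_) (Vec.lookup-replicate τ false)) (Bool.xor-identityʳ (lookup φ τ)))

  distance≤ : ∀ k φ {ψ} → IsCoboundary X k ψ → distance X n k φ ℚ.≤ w X n (φ +ᶜ ψ)
  distance≤ k φ {ψ} ψ∈B =
    min≤ ℚ-totalOrder (λ ψ → w X n (φ +ᶜ ψ)) (isCoboundary? X k) (w X n φ) (∈-allSubsets ψ) ψ∈B

  module _ (pure : IsPure X n) {ℓ} (G : AutomorphismGroup X ℓ) (trans-G : IsTransitiveOn G n) where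

    -- The bound in ℕ is applied to the cleared weight `D` of a nearest representative φ + ψ₀. Since
    -- `φ` is no coboundary, `D` is positive and the division by the distance is a genuine one.
    expansion-ratio : ∀ {k m m′} → k < n → (K : Cone X k m) (K′ : Cone X (suc k) m′) →
      (∀ μ x → Cone.b K′ μ x ≡ coneBase X K μ x) →
      ∀ φ → ¬ IsCoboundary X k φ →
      1/∞ [ (suc n C suc k) * m′ ] ≤ℚ∞ [ w X n (d X φ) ÷₀ distance X n k φ ]
    expansion-ratio {k} {m} {m′} k<n K K′ b≡ φ φ∉B = 1/∞≤ (C₀ * m′) 0<C₀m′ λ c C₀m′≡ →
      1/suc≤÷₀ c (w X n (d X φ)) (distance X n k φ) (mass pure (suc k)) (mass pure (suc (suc k))) D W₁
        (0<mass pure k+1≤) (0<mass pure k+2≤) 0<D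
        (trans (cong (ℚ._* fromℕ (mass pure (suc k))) distance≡) (w-mass pure k+1≤ (φ +ᶜ ψ₀)))
        (w-mass pure k+2≤ (d X φ))
        (subst (λ z → D * (C₁ * N) ≤ z * (W₁ * (C₀ * N))) C₀m′≡ scaled)
      where
      open ℕ.≤-Reasoning
      ψ₀ = proj₁ (distance-attained k φ)
      ψ₀∈B = proj₁ (proj₂ (distance-attained k φ))
      distance≡ = proj₂ (proj₂ (distance-attained k φ))
      C₀ = suc n C suc k
      C₁ = suc n C suc (suc k)
      D  = W X n (lookup (φ +ᶜ ψ₀))
      W₁ = W X n (lookup (d X φ))
      k+1≤ : suc k ≤ suc n
      k+1≤ = s≤s (ℕ.<⇒≤ k<n)
      k+2≤ : suc (suc k) ≤ suc n
      k+2≤ = s≤s k<n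

      D≤ : ∀ ψ → D ≤ W X n (λ τ → lookup φ τ xor dᶠ X ψ τ)
      D≤ ψ = ℕ.≤-trans
        (W-mono-w pure k+1≤ (φ +ᶜ ψ₀) (φ +ᶜ d X (tabulate ψ))
          (subst (ℚ._≤ w X n (φ +ᶜ d X (tabulate ψ))) distance≡ (distance≤ k φ (tabulate ψ , refl))))
        (ℕ.≤-reflexive (sum-cong-≗ λ τ → cong (λ b → bit b * deg X n τ)
          (trans (Vec.lookup-zipWith _xor_ τ φ (d X (tabulate ψ))) (cong (lookup φ τ xor_)
            (trans (lookup-d (tabulate ψ) τ) (sum₂-cong λ σ → cong (facet X σ τ ∧_) (Vec.lookup∘tabulate ψ σ)))))))

      main : D * C₁ ≤ C₀ * m′ * (W₁ * C₀)
      main = subst (λ z → D * C₁ ≤ C₀ * m′ * (z * C₀))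
        (sum-cong-≗ λ ρ → cong (λ b → bit b * deg X n ρ) (sym (lookup-d φ ρ)))
        (expansion pure G trans-G k<n K K′ b≡ (lookup φ) D D≤)

      scaled : D * (C₁ * N) ≤ C₀ * m′ * (W₁ * (C₀ * N))
      scaled = begin
        D * (C₁ * N)                ≡⟨ ℕ.*-assoc D C₁ N ⟨
        D * C₁ * N                  ≤⟨ ℕ.*-monoˡ-≤ N main ⟩
        C₀ * m′ * (W₁ * C₀) * N     ≡⟨ ℕ.*-assoc (C₀ * m′) (W₁ * C₀) N ⟩
        C₀ * m′ * (W₁ * C₀ * N)     ≡⟨ cong (C₀ * m′ *_) (ℕ.*-assoc W₁ C₀ N) ⟩
        C₀ * m′ * (W₁ * (C₀ * N))   ∎

      0<D : 0 < D
      0<D = decidable-stable (0 ℕ.<? D) λ D≡0 → φ∉B (subst (IsCoboundary X k)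
        (lookup-extensionality λ τ → sym (xor≡false⇒≡ (lookup φ τ) (lookup ψ₀ τ)
          (trans (sym (Vec.lookup-zipWith _xor_ τ φ ψ₀)) (W≡0⇒≡false pure (lookup (φ +ᶜ ψ₀)) D≡0 τ))))
        ψ₀∈B)

      -- This excludes the value 1/0 = ∞ on the left: if `C₀ * m′` were 0, `main` would read D C₁ ≤
      -- 0, although both factors are positive.
      0<C₀m′ : 0 < C₀ * m′
      0<C₀m′ = ℕ.n≢0⇒n>0 λ C₀m′≡0 → ℕ.<⇒≱ (ℕ.*-mono-< {0} {D} {0} {C₁} 0<D (0<C k+2≤))
        (ℕ.≤-trans main (ℕ.≤-reflexive (cong (_* (W₁ * C₀)) C₀m′≡0)))

theorem4p3 :
    ∀ {v} (X : SimplicialComplex v) (n : ℕ) → IsPure X n →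
    ∀ {ℓ} (G : AutomorphismGroup X ℓ) → IsTransitiveOn G n →
    ∀ k → k < n →
    (∀ j → j ≤ k → (suc j ·∞ M₋₁₊ X j +∞ 1) <∞ Sys X j) →
    1/∞ ((suc n C suc k) ·∞ M₋₁₊ X (suc k)) ≤ℚ∞ Exp X n k
theorem4p3 X n pure G trans-G k k<n sys =
  subst (λ M → 1/∞ ((suc n C suc k) ·∞ M) ≤ℚ∞ Exp X n k) (sym M≡)
    (≤min ℚ∞-totalOrder (λ φ → [ w X n (d X φ) ÷₀ distance X n k φ ]) (∁? (isCoboundary? X k))
      ⊤⁺ (allCochains X (suc k)) (_ ℚ≤.≤⊤⁺) (expansion-ratio X n pure G trans-G k<n K K′ b≡))
  where
  -- The hypotheses for j < k contract the faces of dimension at most k - 1 and give M_{k-1}; the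
  -- one for j = k is spent on the last extension, which produces M_k.
  coned = cone X (apex X n pure) k λ j j<k → sys j (ℕ.<⇒≤ j<k)
  K = proj₂ (proj₂ coned)
  extended = extend-cone X (proj₁ (proj₂ coned)) (sys k ℕ.≤-refl) K
  M≡ = proj₁ (proj₂ extended)
  K′ = proj₁ (proj₂ (proj₂ extended))
  b≡ = proj₂ (proj₂ (proj₂ extended))
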